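{- For all extended configurations $\mathcal C_1,\mathcal C_2$: if $\mathcal L_{\mathsf{Hasco}}(\mathcal C_1)=\mathcal L_{\mathsf{Hasco}}(\mathcal C_2)$, i.e. $\mathcal C_1$ and $\mathcal C_2$ satisfy the same closed formulae of the logic $\mathcal L_{\mathsf{Hasco}}$, then $\mathcal C_1\approx_{\mathsf{Hasco}}\mathcal C_2$.
   Context: LANGUAGE. $\mathsf{Act}$ is an infinite set of actions with CCS complementation ($\bar{\bar a}=a$); $\tau\notin\mathsf{Act}$; $\mu$ ranges over $\mathsf{Act}\cup\{\tau\}$. Transaction names: $\mathsf{TrN}=\mathsf{inTrN}\uplus\mathsf{exTrN}$ (internal and external names, both infinite). Terms: $P,Q::=\sum_{i\in J}\mu_i.P_i$ ($J$ countable; $\mathbf 0$ is the empty sum) $\mid P\mid Q\mid\nu a.P\mid X\mid\mathrm{rec}X.P\mid[\![P\triangleright_kQ]\!]$ (running transaction named $k$) $\mid\mathrm{co}\mid[\![P\blacktriangleright Q]\!]$ (dormant transaction). $ftn(o)$ is the set of transaction names in $o$; $o\,\sharp\,o'$ means no transaction name of $o$ occurs in $o'$. A process is a well-formed term: (1) it is closed (no free process variables); (2) $ftn$ of it is finite; and for all subterms $[\![P_1\triangleright_kP_1']\!]$, $[\![P_2\blacktriangleright P_2']\!]$, $\sum\mu_i.Q_i$, $\mathrm{rec}X.R$: (3) $P_1,P_1',P_2,P_2',Q_i,R$ contain no transaction names; (4) $P_1,P_2,Q_i$ contain no dormant transactions; (5) $P_1,P_2$ are closed. PROCESS TRANSITIONS.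 $P\xrightarrow{\alpha}_\sigma Q$ with $\alpha\in\{a,\tau,k(\tau),k(a)\}$ and $\sigma$ a name substitution $\tilde k\mapsto l$ (domain the finite tuple $\tilde k$, possibly empty, range $\{l\}$; $\varepsilon$ alone is the empty substitution). Rules (symmetric ones omitted): - $\sum\mu_i.P_i\xrightarrow{\mu_j}_\varepsilon P_j$; - if $P\xrightarrow{a}_\varepsilon P'$ and $Q\xrightarrow{\bar a}_\varepsilon Q'$ then $P\mid Q\xrightarrow{\tau}_\varepsilon P'\mid Q'$; - $\mathrm{rec}X.P\xrightarrow{\tau}_\varepsilon P[\mathrm{rec}X.P/X]$; - if $\mu_j=a$ then $\sum\mu_i.P_i\xrightarrow{k(a)}_{\varepsilon\mapsto k}[\![P_j\mid\mathrm{co}\triangleright_k\sum\mu_i.P_i]\!]$; - if $P\xrightarrow{\mu}_\varepsilon P'$ and $k\,\sharp\,l$ then $[\![P\triangleright_lQ]\!]\xrightarrow{k(\mu)}_{l\mapsto k}[\![P'\triangleright_kQ]\!]$; - if $P\xrightarrow{k(a)}_{\sigma_1}P'$, $Q\xrightarrow{k(\bar a)}_{\sigma_2}Q'$, $\sigma_i=\tilde l_i\mapsto k$, then $P\mid Q\xrightarrow{k(\tau)}_{(\tilde l_1,\tilde l_2)\mapsto k}P'\sigma_2\mid Q'\sigma_1$; - if $P\xrightarrow{\alpha}_\sigma P'$ and $range(\sigma)\,\sharp\,Q$ then $P\mid Q\xrightarrow{\alpha}_\sigma P'\mid Q\sigma$; - if $P\xrightarrow{\alpha}_\sigma P'$ and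 $a$ does not occur in $\alpha$ then $\nu a.P\xrightarrow{\alpha}_\sigma\nu a.P'$. Reconfiguration transitions $P\xrightarrow{\beta}Q$, $\beta\in\{\mathrm{co}\,k,\mathrm{ab}\,k,\mathrm{new}\,k\}$ (symmetric rules omitted): - if $P\equiv\mathrm{co}\mid P''$ for some $P''$ and $P\rightsquigarrow_{\mathrm{co}}P'$ then $[\![P\triangleright_kQ]\!]\xrightarrow{\mathrm{co}\,k}P'$; - $[\![P\blacktriangleright Q]\!]\xrightarrow{\mathrm{new}\,k}[\![P\triangleright_kQ]\!]$; - $[\![P\triangleright_kQ]\!]\xrightarrow{\mathrm{ab}\,k}Q$; - for $\beta=\mathrm{co}\,k$ or $\mathrm{ab}\,k$: if $P\xrightarrow{\beta}P'$ and $Q\xrightarrow{\beta}Q'$ then $P\mid Q\xrightarrow{\beta}P'\mid Q'$; - if $P\xrightarrow{\beta}P'$ and $\beta\,\sharp\,Q$ then $P\mid Q\xrightarrow{\beta}P'\mid Q$; - if $P\xrightarrow{\beta}P'$ then $\nu a.P\xrightarrow{\beta}\nu a.P'$. Here $\equiv$ is standard CCS structural equivalence extended to transactions, and $\rightsquigarrow_{\mathrm{co}}$ is given by: $\mathrm{co}\rightsquigarrow_{\mathrm{co}}\mathbf 0$; sums, variables, $\mathrm{rec}X.P$ and $[\![P\blacktriangleright Q]\!]$ are related to themselves; it is compatible with $\nu a.-$ and $-\mid-$. EXTENDED CONFIGURATIONS AND $\approx_{\mathsf{Hasco}}$. $I$ is a countable index set. An extended configuration is $\langle E;H\bullet P\rangle$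 with $P$ a process, $E$ an equivalence relation over a finite subset of $\mathsf{TrN}$, and $H$ a finite partial function from $I$ to $\{k(a),k(\mathrm{ab}),k(\mathrm{co})\mid k\in\mathsf{exTrN},a\in\mathsf{Act}\}$. Let $H^{\mathrm{trn}}(i)$ be the name used in $H(i)$, $H^{\mathrm{trn}}$ the set of all these, and $\mathrm{Hasco}(H)=\{k\mid\exists i.\,H(i)=k(\mathrm{co})\}$. It is required that: (i) $H^{\mathrm{trn}}(i)=H^{\mathrm{trn}}(j)$ implies $i=j$; (ii) for $k\in\mathsf{exTrN}$, $k\,E\,k$ iff $k\in H^{\mathrm{trn}}$, and $k\,E\,k'$ implies ($k\in\mathrm{Hasco}(H)$ iff $k'\in\mathrm{Hasco}(H)$); (iii) $ftn(P)\cap\mathrm{Hasco}(H)=\emptyset$; (iv) $k\,E\,k'$ and $k,k'\in ftn(P)$ imply $k=k'$. Convention: external names of a configuration are those in its history, i.e. $ftn(P)\cap\mathsf{exTrN}\subseteq H^{\mathrm{trn}}$. "$H,k(a)$" denotes $H$ extended at a new index. For $\sigma=\tilde k\mapsto l$, $\sigma(E)$ is the smallest equivalence relation $F\supseteq E$ with $l\,F\,l$ and $k\,F\,l$ for all $k\in dom(\sigma)$. $(E;H)\setminus_{\mathrm{co}}k$ (resp. $\setminus_{\mathrm{ab}}k$) keeps $E$ and, for every $k'\,E\,k$, changes each $k'(a)$ in $H$ to $k'(\mathrm{co})$ (resp. $k'(\mathrm{ab})$). With $\Delta=E;H$, the extended transitions (labels $\zeta\in\{\tau,k(a)\}$) between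 extended configurations are: - $\langle\Delta\bullet P\rangle\xrightarrow{\tau}_e\langle\Delta\bullet Q\rangle$ if $P\xrightarrow{\tau}_\varepsilon Q$; - $\xrightarrow{\tau}_e\langle\sigma(E);H\bullet Q\rangle$ if $P\xrightarrow{k(\tau)}_\sigma Q$, $k\,\sharp\,E,H$, $k\in\mathsf{inTrN}$; - $\xrightarrow{\tau}_e\langle\Delta\bullet Q\rangle$ if $P\xrightarrow{\mathrm{new}\,k}Q$, $k\,\sharp\,\Delta$, $k\in\mathsf{inTrN}$; - $\xrightarrow{\tau}_e\langle\Delta\setminus_{\mathrm{co}}k\bullet Q\rangle$ if $P\xrightarrow{\mathrm{co}\,k}Q$; - $\xrightarrow{\tau}_e\langle\Delta\setminus_{\mathrm{ab}}k\bullet Q\rangle$ if $P\xrightarrow{\mathrm{ab}\,k}Q$; - $\xrightarrow{k(a)}_e\langle\sigma(E);H,k(a)\bullet Q\rangle$ if $P\xrightarrow{k(a)}_\sigma Q$, $k\,\sharp\,E,H$, $k\in\mathsf{exTrN}$; - $\xrightarrow{k(a)}_e\langle E,(k,k);H,k(\mathrm{ab})\bullet P\rangle$ if $k\,\sharp\,E,H,P$, $k\in\mathsf{exTrN}$. $\stackrel{\tau}{\Rightarrow}_e$ is $(\xrightarrow{\tau}_e)^*$ and $\stackrel{\zeta}{\Rightarrow}_e$ is $\stackrel{\tau}{\Rightarrow}_e\xrightarrow{\zeta}_e\stackrel{\tau}{\Rightarrow}_e$ otherwise. A relation $\mathcal R$ on extended configurations is a $\mathsf{Hasco}$-bisimulation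 if $\mathcal C_1\mathcal R\mathcal C_2$ implies: $\mathrm{Hasco}(\mathcal C_1)=\mathrm{Hasco}(\mathcal C_2)$ (the $\mathrm{Hasco}$ sets of their histories); and if $\mathcal C_1\stackrel{\zeta}{\Rightarrow}_e\mathcal C_1'$ with $\zeta\,\sharp\,\mathcal C_2$ then $\mathcal C_2\stackrel{\zeta}{\Rightarrow}_e\mathcal C_2'$ for some $\mathcal C_2'$ with $\mathcal C_1'\mathcal R\mathcal C_2'$; and conversely. $\approx_{\mathsf{Hasco}}$ is the largest one. LOGIC $\mathcal L_{\mathsf{Hasco}}$. $\mathsf{Var}$ is a countable set of variables disjoint from $\mathsf{exTrN}$. Formulae: $\phi::=\langle\tau\rangle\phi\mid\langle x(a)\rangle\phi\mid\neg\phi\mid\bigwedge_{i\in K}\phi_i$ ($K$ an arbitrary index set) $\mid\mathtt{Hasco}(v)$, with $x\in\mathsf{Var}$, $a\in\mathsf{Act}$, $v\in\mathsf{exTrN}\cup\mathsf{Var}$; $\langle x(a)\rangle\phi$ binds $x$ in $\phi$; closed formulae have no free variables (they may contain names, even infinitely many). Satisfaction for closed formulae: $\mathcal C\models\mathtt{Hasco}(k)$ iff $k\in\mathrm{Hasco}(\mathcal C)$; $\mathcal C\models\langle\tau\rangle\phi$ iff $\mathcal C\stackrel{\tau}{\Rightarrow}_e\mathcal C'$ with $\mathcal C'\models\phi$ for some $\mathcal C'$; $\mathcal C\models\langle x(a)\rangle\phi$ iff there is a cofinite $N\subseteq\mathsf{exTrN}$ such that for all $l\in N$ there is $\mathcal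 C'$ with $\mathcal C\stackrel{l(a)}{\Rightarrow}_e\mathcal C'$ and $\mathcal C'\models\phi[l/x]$; conjunction and negation are standard. $\mathcal L_{\mathsf{Hasco}}(\mathcal C)$ is the set of closed $\phi$ with $\mathcal C\models\phi$. -}

module Defs where

open import Level using (0ℓ; suc; Lift; lift)
open import Data.Bool.Base using (Bool; not; T; if_then_else_)
open import Data.Empty using (⊥)
open import Data.Fin.Base as Fin using (Fin)
open import Data.List.Base using (List; []; _∷_; _++_)
open import Data.List.Membership.Propositional using () renaming (_∈_ to _∈ₗ_; _∉_ to _∉ₗ_)
import Data.List.Membership.DecPropositional as DecMembership
open import Data.Maybe.Base as Maybe using (Maybe; just; nothing)
open import Data.Nat.Base as ℕ using (ℕ)
open import Data.Nat.Properties as ℕₚ using ()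
open import Data.Product.Base using (Σ; ∃; ∃₂; ∃-syntax; _×_; _,_; map₂)
open import Data.Sum.Base using (_⊎_; inj₁; inj₂)
open import Data.Sum.Properties as Sumₚ using ()
open import Data.Unit.Base using (⊤)
open import Function.Base using (_∘_)
open import Function.Bundles using (_↔_; _↣_; _⇔_; mk⇔; Inverse)
open import Function.Properties.Inverse using (↔⇒↣)
open import Relation.Binary.Construct.Closure.ReflexiveTransitive using (Star)
open import Relation.Binary.Core using (Rel)
open import Relation.Binary.Definitions using (DecidableEquality)
open import Relation.Binary.PropositionalEquality using (_≡_; _≢_; refl; sym; subst)
open import Relation.Binary.Structures using (IsPartialEquivalence)
open import Relation.Nullary using (¬_; yes; no; does; contradiction)
open import Relation.Nullary.Decidable using (via-injection)
open import Relation.Unary using (Pred; _∈_; _∉_; _≐_; _∪_; ∅; ∁; ｛_｝; Empty)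

Infinite : Set → Set
Infinite A = (xs : List A) → ∃[ x ] x ∉ₗ xs

Finite : ∀ {ℓ} {A : Set} → Pred A ℓ → Set ℓ
Finite {A = A} U = Σ (List A) λ xs → ∀ {x} → x ∈ U → x ∈ₗ xs

Cofinite : {A : Set} → Pred A 0ℓ → Set
Cofinite U = Finite (∁ U)

-- Codes for the countable sets, up to bijection.
data Countable : Set where
  finite   : ℕ → Countable
  infinite : Countable

El : Countable → Set
El (finite n) = Fin n
El infinite   = ℕ

-- Equality on names is assumed decidable, which classically holds of every
-- set.  Complementation has no fixed points: an action is a CCS name or a
-- co-name.  Var must be countably infinite; I is any countable set.
record Signature : Set₁ where
  field
    Act inTrN exTrN Var I : Set

    bar            : Act → Act
    bar-involutive : ∀ a → bar (bar a) ≡ a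
    bar-irreflexive : ∀ a → bar a ≢ a

    Act-infinite   : Infinite Act
    inTrN-infinite : Infinite inTrN
    exTrN-infinite : Infinite exTrN
    Var-countable  : Var ↔ ℕ
    I-countable    : I ↣ ℕ

    _≟ⁱⁿ_ : DecidableEquality inTrN
    _≟ᵉˣ_ : DecidableEquality exTrN

module Calculus (S : Signature) where

  open Signature S

  TrN : Set
  TrN = inTrN ⊎ exTrN

  -- Abstract, so that `with` can split on these decisions.
  abstract
    _≟ᵗ_ : DecidableEquality TrN
    _≟ᵗ_ = Sumₚ.≡-dec _≟ⁱⁿ_ _≟ᵉˣ_

    _≟ᵛ_ : DecidableEquality Var
    _≟ᵛ_ = via-injection (↔⇒↣ Var-countable) ℕₚ._≟_

    _≟ᴵ_ : DecidableEquality I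
    _≟ᴵ_ = via-injection I-countable ℕₚ._≟_

  open DecMembership _≟ᵗ_ using (_∈?_)

  -- Terms up to α-equivalence.  In Term m n there are m restricted
  -- channels and n process variables in scope, both as de Bruijn indices.
  -- A restricted channel c yields two complementary actions,
  -- bound c true and bound c false.

  data Action (m : ℕ) : Set where
    free  : Act → Action m
    bound : Fin m → Bool → Action m

  barᵃ : ∀ {m} → Action m → Action m
  barᵃ (free a)    = free (bar a)
  barᵃ (bound c p) = bound c (not p)

  data Prefix (m : ℕ) : Set where
    τ   : Prefix m
    act : Action m → Prefix m

  infixr 6 _∣_

  data Term (m n : ℕ) : Set where
    sum      : (J : Countable) → (El J → Prefix m) → (El J → Term m n) → Term m n
    _∣_      : Term m n → Term m n → Term m n
    ν        : Term (ℕ.suc m) n → Term m n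
    var      : Fin n → Term m n
    rec      : Term m (ℕ.suc n) → Term m n
    ⟦_▷[_]_⟧ : Term m n → TrN → Term m n → Term m n
    co       : Term m n
    ⟦_▶_⟧    : Term m n → Term m n → Term m n

  𝟎 : ∀ {m n} → Term m n
  𝟎 = sum (finite 0) (λ ()) (λ ())

  renᵃ : ∀ {m m′} → (Fin m → Fin m′) → Action m → Action m′
  renᵃ f (free a)    = free a
  renᵃ f (bound c p) = bound (f c) p

  renᵖ : ∀ {m m′} → (Fin m → Fin m′) → Prefix m → Prefix m′
  renᵖ f τ       = τ
  renᵖ f (act a) = act (renᵃ f a)

  lift₁ : ∀ {m m′} → (Fin m → Fin m′) → Fin (ℕ.suc m) → Fin (ℕ.suc m′)
  lift₁ f Fin.zero    = Fin.zero
  lift₁ f (Fin.suc i) = Fin.suc (f i)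

  ren : ∀ {m m′ n n′} → (Fin m → Fin m′) → (Fin n → Fin n′) → Term m n → Term m′ n′
  ren f g (sum J μ P)     = sum J (renᵖ f ∘ μ) (λ j → ren f g (P j))
  ren f g (P ∣ Q)         = ren f g P ∣ ren f g Q
  ren f g (ν P)           = ν (ren (lift₁ f) g P)
  ren f g (var X)         = var (g X)
  ren f g (rec P)         = rec (ren f (lift₁ g) P)
  ren f g ⟦ P ▷[ k ] Q ⟧  = ⟦ ren f g P ▷[ k ] ren f g Q ⟧
  ren f g co              = co
  ren f g ⟦ P ▶ Q ⟧       = ⟦ ren f g P ▶ ren f g Q ⟧

  renᶜ : ∀ {m m′ n} → (Fin m → Fin m′) → Term m n → Term m′ n
  renᶜ f = ren f (λ X → X)

  swap₀₁ : ∀ {m} → Fin (ℕ.suc (ℕ.suc m)) → Fin (ℕ.suc (ℕ.suc m))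
  swap₀₁ Fin.zero              = Fin.suc Fin.zero
  swap₀₁ (Fin.suc Fin.zero)    = Fin.zero
  swap₀₁ (Fin.suc (Fin.suc c)) = Fin.suc (Fin.suc c)

  liftₛ : ∀ {m n n′} → (Fin n → Term m n′) → Fin (ℕ.suc n) → Term m (ℕ.suc n′)
  liftₛ s Fin.zero    = var Fin.zero
  liftₛ s (Fin.suc X) = ren (λ c → c) Fin.suc (s X)

  sub : ∀ {m n n′} → (Fin n → Term m n′) → Term m n → Term m n′
  sub s (sum J μ P)    = sum J μ (λ j → sub s (P j))
  sub s (P ∣ Q)        = sub s P ∣ sub s Q
  sub s (ν P)          = ν (sub (renᶜ Fin.suc ∘ s) P)
  sub s (var X)        = s X
  sub s (rec P)        = rec (sub (liftₛ s) P)
  sub s ⟦ P ▷[ k ] Q ⟧ = ⟦ sub s P ▷[ k ] sub s Q ⟧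
  sub s co             = co
  sub s ⟦ P ▶ Q ⟧      = ⟦ sub s P ▶ sub s Q ⟧

  _[_/0] : ∀ {m n} → Term m (ℕ.suc n) → Term m n → Term m n
  P [ Q /0] = sub (λ { Fin.zero → Q ; (Fin.suc X) → var X }) P

  ftn : ∀ {m n} → Term m n → Pred TrN 0ℓ
  ftn (sum J μ P)    = λ k → ∃[ j ] k ∈ ftn (P j)
  ftn (P ∣ Q)        = ftn P ∪ ftn Q
  ftn (ν P)          = ftn P
  ftn (var X)        = ∅
  ftn (rec P)        = ftn P
  ftn ⟦ P ▷[ k ] Q ⟧ = ｛ k ｝ ∪ ftn P ∪ ftn Q
  ftn co             = ∅
  ftn ⟦ P ▶ Q ⟧      = ftn P ∪ ftn Q

  fpv : ∀ {m n} → Term m n → Pred (Fin n) 0ℓ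
  fpv (sum J μ P)    = λ X → ∃[ j ] X ∈ fpv (P j)
  fpv (P ∣ Q)        = fpv P ∪ fpv Q
  fpv (ν P)          = fpv P
  fpv (var X)        = ｛ X ｝
  fpv (rec P)        = λ X → Fin.suc X ∈ fpv P
  fpv ⟦ P ▷[ k ] Q ⟧ = fpv P ∪ fpv Q
  fpv co             = ∅
  fpv ⟦ P ▶ Q ⟧      = fpv P ∪ fpv Q

  NoTrN : ∀ {m n} → Term m n → Set
  NoTrN P = Empty (ftn P)

  ClosedTerm : ∀ {m n} → Term m n → Set
  ClosedTerm P = Empty (fpv P)

  NoDormant : ∀ {m n} → Term m n → Set
  NoDormant (sum J μ P)    = ∀ j → NoDormant (P j)
  NoDormant (P ∣ Q)        = NoDormant P × NoDormant Q
  NoDormant (ν P)          = NoDormant P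
  NoDormant (var X)        = ⊤
  NoDormant (rec P)        = NoDormant P
  NoDormant ⟦ P ▷[ k ] Q ⟧ = NoDormant P × NoDormant Q
  NoDormant co             = ⊤
  NoDormant ⟦ P ▶ Q ⟧      = ⊥

  SubtermsOK : ∀ {m n} → Term m n → Set
  SubtermsOK (sum J μ P)    = ∀ j → NoTrN (P j) × NoDormant (P j) × SubtermsOK (P j)
  SubtermsOK (P ∣ Q)        = SubtermsOK P × SubtermsOK Q
  SubtermsOK (ν P)          = SubtermsOK P
  SubtermsOK (var X)        = ⊤
  SubtermsOK (rec P)        = NoTrN P × SubtermsOK P
  SubtermsOK ⟦ P ▷[ k ] Q ⟧ =
    NoTrN P × NoTrN Q × NoDormant P × ClosedTerm P × SubtermsOK P × SubtermsOK Q
  SubtermsOK co             = ⊤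
  SubtermsOK ⟦ P ▶ Q ⟧      =
    NoTrN P × NoTrN Q × NoDormant P × ClosedTerm P × SubtermsOK P × SubtermsOK Q

  IsProcess : Term 0 0 → Set
  IsProcess P = Finite (ftn P) × SubtermsOK P

  -- Transaction-name substitutions.  [] ↦ l is distinct from ε: its
  -- domain is empty but its range is {l}.

  infix 5 _↦_

  data NameSub : Set where
    ε   : NameSub
    _↦_ : List TrN → TrN → NameSub

  dom range : NameSub → Pred TrN 0ℓ
  dom ε        = ∅
  dom (ks ↦ l) = _∈ₗ ks
  range ε        = ∅
  range (ks ↦ l) = ｛ l ｝

  substᵗ : NameSub → TrN → TrN
  substᵗ ε        k = k
  substᵗ (ks ↦ l) k = if does (k ∈? ks) then l else k

  infixl 7 _⟨_⟩

  _⟨_⟩ : ∀ {m n} → Term m n → NameSub → Term m n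
  sum J μ P      ⟨ σ ⟩ = sum J μ (λ j → P j ⟨ σ ⟩)
  (P ∣ Q)        ⟨ σ ⟩ = P ⟨ σ ⟩ ∣ Q ⟨ σ ⟩
  ν P            ⟨ σ ⟩ = ν (P ⟨ σ ⟩)
  var X          ⟨ σ ⟩ = var X
  rec P          ⟨ σ ⟩ = rec (P ⟨ σ ⟩)
  ⟦ P ▷[ k ] Q ⟧ ⟨ σ ⟩ = ⟦ P ⟨ σ ⟩ ▷[ substᵗ σ k ] Q ⟨ σ ⟩ ⟧
  co             ⟨ σ ⟩ = co
  ⟦ P ▶ Q ⟧      ⟨ σ ⟩ = ⟦ P ⟨ σ ⟩ ▶ Q ⟨ σ ⟩ ⟧

  data Label (m : ℕ) : Set where
    ‹_›  : Prefix m → Label m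
    _⟪_⟫ : TrN → Prefix m → Label m

  weaken : ∀ {m} → Label m → Label (ℕ.suc m)
  weaken ‹ μ ›     = ‹ renᵖ Fin.suc μ ›
  weaken (k ⟪ μ ⟫) = k ⟪ renᵖ Fin.suc μ ⟫

  infix 4 _—[_∙_]→_ _—[_]→ʳ_

  data _—[_∙_]→_ {m : ℕ} : Term m 0 → Label m → NameSub → Term m 0 → Set where

    choose : ∀ {J μ P} (j : El J) →
             sum J μ P —[ ‹ μ j › ∙ ε ]→ P j

    comm : ∀ {a P P′ Q Q′} →
           P —[ ‹ act a › ∙ ε ]→ P′ →
           Q —[ ‹ act (barᵃ a) › ∙ ε ]→ Q′ →
           P ∣ Q —[ ‹ τ › ∙ ε ]→ P′ ∣ Q′

    unfold : ∀ {P} →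
             rec P —[ ‹ τ › ∙ ε ]→ P [ rec P /0]

    choose-tr : ∀ {J μ P a} k (j : El J) → μ j ≡ act a →
                sum J μ P —[ k ⟪ act a ⟫ ∙ [] ↦ k ]→ ⟦ P j ∣ co ▷[ k ] sum J μ P ⟧

    step-tr : ∀ {P P′ Q μ k l} →
              P —[ ‹ μ › ∙ ε ]→ P′ →
              k ≢ l →
              ⟦ P ▷[ l ] Q ⟧ —[ k ⟪ μ ⟫ ∙ (l ∷ []) ↦ k ]→ ⟦ P′ ▷[ k ] Q ⟧

    comm-tr : ∀ {a k ls₁ ls₂ P P′ Q Q′} →
              P —[ k ⟪ act a ⟫ ∙ ls₁ ↦ k ]→ P′ →
              Q —[ k ⟪ act (barᵃ a) ⟫ ∙ ls₂ ↦ k ]→ Q′ →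
              P ∣ Q —[ k ⟪ τ ⟫ ∙ (ls₁ ++ ls₂) ↦ k ]→ P′ ⟨ ls₂ ↦ k ⟩ ∣ Q′ ⟨ ls₁ ↦ k ⟩

    parˡ : ∀ {α σ P P′ Q} →
           P —[ α ∙ σ ]→ P′ →
           (∀ {l} → l ∈ range σ → l ∉ ftn Q) →
           P ∣ Q —[ α ∙ σ ]→ P′ ∣ Q ⟨ σ ⟩

    parʳ : ∀ {α σ P Q Q′} →
           Q —[ α ∙ σ ]→ Q′ →
           (∀ {l} → l ∈ range σ → l ∉ ftn P) →
           P ∣ Q —[ α ∙ σ ]→ P ⟨ σ ⟩ ∣ Q′

    -- The label of the premise is a weakened one, so it does not mention
    -- the restricted channel.
    res : ∀ {α σ P P′} →
          P —[ weaken α ∙ σ ]→ P′ →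
          ν P —[ α ∙ σ ]→ ν P′

  -- α-conversion is built into the syntax.  The axioms are those of CCS; the
  -- transaction constructs only contribute congruence rules.

  infix 4 _≡ₛ_

  data _≡ₛ_ {m n : ℕ} : Term m n → Term m n → Set where
    ≡ₛ-refl  : ∀ {P} → P ≡ₛ P
    ≡ₛ-sym   : ∀ {P Q} → P ≡ₛ Q → Q ≡ₛ P
    ≡ₛ-trans : ∀ {P Q R} → P ≡ₛ Q → Q ≡ₛ R → P ≡ₛ R

    ∣-comm     : ∀ {P Q} → P ∣ Q ≡ₛ Q ∣ P
    ∣-assoc    : ∀ {P Q R} → (P ∣ Q) ∣ R ≡ₛ P ∣ (Q ∣ R)
    ∣-identity : ∀ {P} → P ∣ 𝟎 ≡ₛ P
    ν-swap     : ∀ {P} → ν (ν P) ≡ₛ ν (ν (renᶜ swap₀₁ P))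
    ν-𝟎        : ν 𝟎 ≡ₛ 𝟎
    ν-extrude  : ∀ {P Q} → ν (renᶜ Fin.suc P ∣ Q) ≡ₛ P ∣ ν Q

    -- Commutativity and associativity of choice: summands may be
    -- re-indexed along a bijection.
    sum-reindex : ∀ {J J′ μ P} (f : El J ↔ El J′) →
                  sum J (μ ∘ Inverse.to f) (P ∘ Inverse.to f) ≡ₛ sum J′ μ P

    sum-cong : ∀ {J μ P Q} → (∀ j → P j ≡ₛ Q j) → sum J μ P ≡ₛ sum J μ Q
    ∣-cong   : ∀ {P P′ Q Q′} → P ≡ₛ P′ → Q ≡ₛ Q′ → P ∣ Q ≡ₛ P′ ∣ Q′
    ν-cong   : ∀ {P Q} → P ≡ₛ Q → ν P ≡ₛ ν Q
    rec-cong : ∀ {P Q} → P ≡ₛ Q → rec P ≡ₛ rec Q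
    ▷-cong   : ∀ {k P P′ Q Q′} → P ≡ₛ P′ → Q ≡ₛ Q′ → ⟦ P ▷[ k ] Q ⟧ ≡ₛ ⟦ P′ ▷[ k ] Q′ ⟧
    ▶-cong   : ∀ {P P′ Q Q′} → P ≡ₛ P′ → Q ≡ₛ Q′ → ⟦ P ▶ Q ⟧ ≡ₛ ⟦ P′ ▶ Q′ ⟧

  infix 4 _⇝co_

  data _⇝co_ {m n : ℕ} : Term m n → Term m n → Set where
    co⇝  : co ⇝co 𝟎
    sum⇝ : ∀ {J μ P} → sum J μ P ⇝co sum J μ P
    var⇝ : ∀ {X} → var X ⇝co var X
    rec⇝ : ∀ {P} → rec P ⇝co rec P
    ▶⇝   : ∀ {P Q} → ⟦ P ▶ Q ⟧ ⇝co ⟦ P ▶ Q ⟧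
    ν⇝   : ∀ {P P′} → P ⇝co P′ → ν P ⇝co ν P′
    ∣⇝   : ∀ {P P′ Q Q′} → P ⇝co P′ → Q ⇝co Q′ → P ∣ Q ⇝co P′ ∣ Q′

  data Reconf : Set where
    coᵇ abᵇ newᵇ : TrN → Reconf

  nameᵇ : Reconf → TrN
  nameᵇ (coᵇ k)  = k
  nameᵇ (abᵇ k)  = k
  nameᵇ (newᵇ k) = k

  data Broadcast : Reconf → Set where
    co-bc : ∀ {k} → Broadcast (coᵇ k)
    ab-bc : ∀ {k} → Broadcast (abᵇ k)

  data _—[_]→ʳ_ {m : ℕ} : Term m 0 → Reconf → Term m 0 → Set where

    commit : ∀ {P P′ P″ Q k} → P ≡ₛ co ∣ P″ → P ⇝co P′ →
             ⟦ P ▷[ k ] Q ⟧ —[ coᵇ k ]→ʳ P′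

    start : ∀ {P Q k} →
            ⟦ P ▶ Q ⟧ —[ newᵇ k ]→ʳ ⟦ P ▷[ k ] Q ⟧

    abort : ∀ {P Q k} →
            ⟦ P ▷[ k ] Q ⟧ —[ abᵇ k ]→ʳ Q

    both : ∀ {β P P′ Q Q′} → Broadcast β →
           P —[ β ]→ʳ P′ → Q —[ β ]→ʳ Q′ →
           P ∣ Q —[ β ]→ʳ P′ ∣ Q′

    parˡ : ∀ {β P P′ Q} → P —[ β ]→ʳ P′ → nameᵇ β ∉ ftn Q →
           P ∣ Q —[ β ]→ʳ P′ ∣ Q

    parʳ : ∀ {β P Q Q′} → Q —[ β ]→ʳ Q′ → nameᵇ β ∉ ftn P →
           P ∣ Q —[ β ]→ʳ P ∣ Q′

    res : ∀ {β P P′} → P —[ β ]→ʳ P′ →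
          ν P —[ β ]→ʳ ν P′

  -- Relations on names are given by characteristic functions.
  NameRel : Set
  NameRel = TrN → TrN → Bool

  holds : NameRel → Rel TrN 0ℓ
  holds E k k′ = T (E k k′)

  _represents_ : NameRel → Rel TrN 0ℓ → Set
  E represents R = ∀ k k′ → holds E k k′ ⇔ R k k′

  -- An equivalence relation over a subset of TrN is a partial equivalence on
  -- TrN; the subset is its field.
  field′ : NameRel → Pred TrN 0ℓ
  field′ E k = holds E k k

  data Status : Set where
    performed : Act → Status
    aborted committed : Status

  History : Set
  History = I → Maybe (exTrN × Status)

  domᴴ : History → Pred I 0ℓ
  domᴴ H i = ∃[ e ] H i ≡ just e

  trnᴴ : History → Pred TrN 0ℓ
  trnᴴ H (inj₁ k) = ⊥
  trnᴴ H (inj₂ k) = ∃₂ λ i s → H i ≡ just (k , s)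

  Hascoᴴ : History → Pred exTrN 0ℓ
  Hascoᴴ H k = ∃[ i ] H i ≡ just (k , committed)

  record Raw : Set where
    constructor ⟨_⨾_●_⟩
    field
      eqv  : NameRel
      hist : History
      proc : Term 0 0

  record Valid (C : Raw) : Set where
    open Raw C renaming (eqv to E; hist to H; proc to P)
    field
      isProcess   : IsProcess P
      equivalence : IsPartialEquivalence (holds E)
      finiteField : Finite (field′ E)
      finiteHist  : Finite (domᴴ H)
      uniqueIndex : ∀ {i j k s s′} → H i ≡ just (k , s) → H j ≡ just (k , s′) → i ≡ j
      field⇔trn   : ∀ k → inj₂ k ∈ field′ E ⇔ inj₂ k ∈ trnᴴ H
      -- Only external names are compared: an internal name is never in Hasco,
      -- yet may be merged with an external one that later commits.
      hasco-resp  : ∀ {k k′} → holds E (inj₂ k) (inj₂ k′) → k ∈ Hascoᴴ H ⇔ k′ ∈ Hascoᴴ H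
      ftn∩hasco   : ∀ {k} → inj₂ k ∈ ftn P → k ∉ Hascoᴴ H
      ftn-unique  : ∀ {k k′} → holds E k k′ → k ∈ ftn P → k′ ∈ ftn P → k ≡ k′
      ftn⊆trn     : ∀ {k} → inj₂ k ∈ ftn P → inj₂ k ∈ trnᴴ H

  -- Validity is irrelevant, so configurations are determined by ⟨ E ⨾ H ● P ⟩.
  record Config : Set where
    constructor config
    field
      raw    : Raw
      .valid : Valid raw
    open Raw raw public

  open Config using (raw; eqv; hist; proc)

  Hasco : Config → Pred exTrN 0ℓ
  Hasco C = Hascoᴴ (hist C)

  -- σ(E): being the smallest such relation is what the inductive family says.
  data Merge (σ : NameSub) (E : NameRel) : Rel TrN 0ℓ where
    old    : ∀ {k k′} → holds E k k′ → Merge σ E k k′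
    target : ∀ {l} → l ∈ range σ → Merge σ E l l
    source : ∀ {k l} → k ∈ dom σ → l ∈ range σ → Merge σ E k l
    symm   : ∀ {k k′} → Merge σ E k k′ → Merge σ E k′ k
    tran   : ∀ {k k′ k″} → Merge σ E k k′ → Merge σ E k′ k″ → Merge σ E k k″

  _⊕_ : NameRel → TrN → Rel TrN 0ℓ
  (E ⊕ k) k₁ k₂ = holds E k₁ k₂ ⊎ (k₁ ≡ k × k₂ ≡ k)

  _,_↪_ : History → I → exTrN × Status → History
  (H , i ↪ e) j = if does (i ≟ᴵ j) then just e else H j

  resolveˢ : Status → Status → Status
  resolveˢ new (performed a) = new
  resolveˢ new aborted       = aborted
  resolveˢ new committed     = committed

  -- The history of (E ; H) ∖ k with new = committed (∖co) or aborted (∖ab);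
  -- only entries of the form k′(a) change.
  resolve : Status → NameRel → TrN → History → History
  resolve new E k H i =
    Maybe.map (λ { (k′ , s) → k′ , (if E (inj₂ k′) k then resolveˢ new s else s) }) (H i)

  Fresh : TrN → NameRel → History → Set
  Fresh k E H = k ∉ field′ E × k ∉ trnᴴ H

  data ELabel : Set where
    τ    : ELabel
    _⟪_⟫ : exTrN → Act → ELabel

  infix 4 _—⟨_⟩→_ _→ᵉ⟨_⟩_ _⇒_ _⇒⟨_⟩_

  data _—⟨_⟩→_ : Raw → ELabel → Raw → Set where

    internal : ∀ {E H P Q} →
      P —[ ‹ τ › ∙ ε ]→ Q →
      ⟨ E ⨾ H ● P ⟩ —⟨ τ ⟩→ ⟨ E ⨾ H ● Q ⟩

    internal-tr : ∀ {E E′ H P Q k σ} →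
      P —[ inj₁ k ⟪ τ ⟫ ∙ σ ]→ Q →
      Fresh (inj₁ k) E H →
      E′ represents Merge σ E →
      ⟨ E ⨾ H ● P ⟩ —⟨ τ ⟩→ ⟨ E′ ⨾ H ● Q ⟩

    new-tr : ∀ {E H P Q k} →
      P —[ newᵇ (inj₁ k) ]→ʳ Q →
      Fresh (inj₁ k) E H →
      ⟨ E ⨾ H ● P ⟩ —⟨ τ ⟩→ ⟨ E ⨾ H ● Q ⟩

    commit-tr : ∀ {E H P Q k} →
      P —[ coᵇ k ]→ʳ Q →
      ⟨ E ⨾ H ● P ⟩ —⟨ τ ⟩→ ⟨ E ⨾ resolve committed E k H ● Q ⟩

    abort-tr : ∀ {E H P Q k} →
      P —[ abᵇ k ]→ʳ Q →
      ⟨ E ⨾ H ● P ⟩ —⟨ τ ⟩→ ⟨ E ⨾ resolve aborted E k H ● Q ⟩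

    external : ∀ {E E′ H P Q k a σ i} →
      P —[ inj₂ k ⟪ act (free a) ⟫ ∙ σ ]→ Q →
      Fresh (inj₂ k) E H →
      i ∉ domᴴ H →
      E′ represents Merge σ E →
      ⟨ E ⨾ H ● P ⟩ —⟨ k ⟪ a ⟫ ⟩→ ⟨ E′ ⨾ (H , i ↪ (k , performed a)) ● Q ⟩

    external-ab : ∀ {E E′ H P k a i} →
      Fresh (inj₂ k) E H →
      inj₂ k ∉ ftn P →
      i ∉ domᴴ H →
      E′ represents (E ⊕ inj₂ k) →
      ⟨ E ⨾ H ● P ⟩ —⟨ k ⟪ a ⟫ ⟩→ ⟨ E′ ⨾ (H , i ↪ (k , aborted)) ● P ⟩

  _→ᵉ⟨_⟩_ : Config → ELabel → Config → Set
  C →ᵉ⟨ ζ ⟩ D = raw C —⟨ ζ ⟩→ raw D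

  _⇒_ : Rel Config 0ℓ
  _⇒_ = Star (_→ᵉ⟨ τ ⟩_)

  _⇒⟨_⟩_ : Config → ELabel → Config → Set
  C ⇒⟨ τ ⟩ D         = C ⇒ D
  C ⇒⟨ k ⟪ a ⟫ ⟩ D = ∃₂ λ C′ D′ → C ⇒ C′ × C′ →ᵉ⟨ k ⟪ a ⟫ ⟩ D′ × D′ ⇒ D

  infix 4 _♯_ _≈Hasco_

  _♯_ : ELabel → Config → Set
  τ         ♯ C = ⊤
  (k ⟪ a ⟫) ♯ C = Fresh (inj₂ k) (eqv C) (hist C) × inj₂ k ∉ ftn (proc C)

  record IsHascoBisimulation (R : Rel Config 0ℓ) : Set where
    field
      hasco : ∀ {C D} → R C D → Hasco C ≐ Hasco D
      forth : ∀ {C D C′ ζ} → R C D → C ⇒⟨ ζ ⟩ C′ → ζ ♯ D →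
              ∃[ D′ ] (D ⇒⟨ ζ ⟩ D′) × R C′ D′
      back  : ∀ {C D D′ ζ} → R C D → D ⇒⟨ ζ ⟩ D′ → ζ ♯ C →
              ∃[ C′ ] (C ⇒⟨ ζ ⟩ C′) × R C′ D′

  _≈Hasco_ : Config → Config → Set₁
  C ≈Hasco D = ∃[ R ] IsHascoBisimulation R × R C D

  Value : Set
  Value = exTrN ⊎ Var

  data Form : Set₁ where
    ⟨τ⟩_   : Form → Form
    ⟨_⦅_⦆⟩_ : Var → Act → Form → Form
    ¬̇_     : Form → Form
    ⋀      : (K : Set) → (K → Form) → Form
    hasco  : Value → Form

  fv : Form → Pred Var 0ℓ
  fv (⟨τ⟩ φ)         = fv φ
  fv (⟨ x ⦅ a ⦆⟩ φ)  = λ y → y ∈ fv φ × y ≢ x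
  fv (¬̇ φ)           = fv φ
  fv (⋀ K φ)         = λ y → ∃[ i ] y ∈ fv (φ i)
  fv (hasco (inj₁ k)) = ∅
  fv (hasco (inj₂ x)) = ｛ x ｝

  Closed : Form → Set
  Closed φ = Empty (fv φ)

  Env : Set
  Env = Var → Value

  _[_≔_] : Env → Var → exTrN → Env
  (ρ [ x ≔ l ]) y = if does (x ≟ᵛ y) then inj₁ l else ρ y

  applyᵛ : Env → Value → Value
  applyᵛ ρ (inj₁ k) = inj₁ k
  applyᵛ ρ (inj₂ x) = ρ x

  hascoᵛ : Config → Value → Set
  hascoᵛ C (inj₁ k) = k ∈ Hasco C
  hascoᵛ C (inj₂ x) = ⊥

  -- C ⊨ φ [ ρ ] is satisfaction of φ under the simultaneous substitution ρ.
  -- Delaying the substitution makes the recursion structural; ⊨-bind below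
  -- is the clause for ⟨ x ⦅ a ⦆⟩ φ in terms of φ [ l / x ].  The ⊥ clause of
  -- hascoᵛ is never reached from a closed formula.
  infix 4 _⊨_[_] _⊨_

  _⊨_[_] : Config → Form → Env → Set₁
  C ⊨ ⟨τ⟩ φ [ ρ ]        = ∃[ C′ ] (C ⇒⟨ τ ⟩ C′) × C′ ⊨ φ [ ρ ]
  C ⊨ ⟨ x ⦅ a ⦆⟩ φ [ ρ ] =
    Σ (Pred exTrN 0ℓ) λ N → Cofinite N ×
      (∀ l → l ∈ N → ∃[ C′ ] (C ⇒⟨ l ⟪ a ⟫ ⟩ C′) × C′ ⊨ φ [ ρ [ x ≔ l ] ])
  C ⊨ ¬̇ φ [ ρ ]          = ¬ (C ⊨ φ [ ρ ])
  C ⊨ ⋀ K φ [ ρ ]        = (i : K) → C ⊨ φ i [ ρ ]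
  C ⊨ hasco v [ ρ ]      = Lift (suc 0ℓ) (hascoᵛ C (applyᵛ ρ v))

  _⊨_ : Config → Form → Set₁
  C ⊨ φ = C ⊨ φ [ inj₂ ]

  𝓛Hasco : Config → Pred Form (suc 0ℓ)
  𝓛Hasco C φ = Closed φ × C ⊨ φ

  _[_/_] : Form → exTrN → Var → Form
  (⟨τ⟩ φ)        [ l / x ] = ⟨τ⟩ (φ [ l / x ])
  (⟨ y ⦅ a ⦆⟩ φ) [ l / x ] = ⟨ y ⦅ a ⦆⟩ (if does (x ≟ᵛ y) then φ else φ [ l / x ])
  (¬̇ φ)          [ l / x ] = ¬̇ (φ [ l / x ])
  ⋀ K φ          [ l / x ] = ⋀ K (λ i → φ i [ l / x ])
  hasco v        [ l / x ] = hasco (applyᵛ (inj₂ [ x ≔ l ]) v)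

  _≗ᵉ_ : Rel Env 0ℓ
  ρ ≗ᵉ ρ′ = ∀ y → ρ y ≡ ρ′ y

  ≗ᵉ-sym : ∀ {ρ ρ′} → ρ ≗ᵉ ρ′ → ρ′ ≗ᵉ ρ
  ≗ᵉ-sym e y = sym (e y)

  ext-cong : ∀ {ρ ρ′} x l → ρ ≗ᵉ ρ′ → (ρ [ x ≔ l ]) ≗ᵉ (ρ′ [ x ≔ l ])
  ext-cong x l e y with x ≟ᵛ y
  ... | yes _ = refl
  ... | no  _ = e y

  ext-shadow : ∀ ρ x l l′ → (ρ [ x ≔ l′ ]) ≗ᵉ ((ρ [ x ≔ l ]) [ x ≔ l′ ])
  ext-shadow ρ x l l′ z with x ≟ᵛ z
  ... | yes _ = refl
  ... | no  _ = refl

  ext-swap : ∀ ρ {x y} l l′ → x ≢ y →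
             ((ρ [ y ≔ l′ ]) [ x ≔ l ]) ≗ᵉ ((ρ [ x ≔ l ]) [ y ≔ l′ ])
  ext-swap ρ {x} {y} l l′ x≢y z with x ≟ᵛ z | y ≟ᵛ z
  ... | yes refl | yes refl = contradiction refl x≢y
  ... | yes _    | no _     = refl
  ... | no _     | yes _    = refl
  ... | no _     | no _     = refl

  ⊨-cong : ∀ {C} φ {ρ ρ′} → ρ ≗ᵉ ρ′ → C ⊨ φ [ ρ ] → C ⊨ φ [ ρ′ ]
  ⊨-cong (⟨τ⟩ φ) e (C′ , s , p) = C′ , s , ⊨-cong φ e p
  ⊨-cong (⟨ x ⦅ a ⦆⟩ φ) e (N , c , f) =
    N , c , λ l l∈N → map₂ (map₂ (⊨-cong φ (ext-cong x l e))) (f l l∈N)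
  ⊨-cong (¬̇ φ) e p q = p (⊨-cong φ (≗ᵉ-sym e) q)
  ⊨-cong (⋀ K φ) e p i = ⊨-cong (φ i) e (p i)
  ⊨-cong (hasco (inj₁ k)) e p = p
  ⊨-cong {C} (hasco (inj₂ x)) e (lift p) = lift (subst (hascoᵛ C) (e x) p)

  applyᵛ-subst : ∀ ρ x l v →
    applyᵛ ρ (applyᵛ (inj₂ [ x ≔ l ]) v) ≡ applyᵛ (ρ [ x ≔ l ]) v
  applyᵛ-subst ρ x l (inj₁ k) = refl
  applyᵛ-subst ρ x l (inj₂ y) with x ≟ᵛ y
  ... | yes _ = refl
  ... | no  _ = refl

  mutual
    ⊨-subst⁺ : ∀ {C} φ {ρ} x l → C ⊨ φ [ ρ [ x ≔ l ] ] → C ⊨ (φ [ l / x ]) [ ρ ]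
    ⊨-subst⁺ (⟨τ⟩ φ) x l (C′ , s , p) = C′ , s , ⊨-subst⁺ φ x l p
    ⊨-subst⁺ (⟨ y ⦅ a ⦆⟩ φ) {ρ} x l (N , c , f) with x ≟ᵛ y
    ... | yes refl = N , c , λ l′ i →
            map₂ (map₂ (⊨-cong φ (≗ᵉ-sym (ext-shadow ρ x l l′)))) (f l′ i)
    ... | no x≢y = N , c , λ l′ i →
            map₂ (map₂ (⊨-subst⁺ φ x l ∘ ⊨-cong φ (≗ᵉ-sym (ext-swap ρ l l′ x≢y)))) (f l′ i)
    ⊨-subst⁺ (¬̇ φ) x l p q = p (⊨-subst⁻ φ x l q)
    ⊨-subst⁺ (⋀ K φ) x l p i = ⊨-subst⁺ (φ i) x l (p i)
    ⊨-subst⁺ {C} (hasco v) {ρ} x l (lift p) =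
      lift (subst (hascoᵛ C) (sym (applyᵛ-subst ρ x l v)) p)

    ⊨-subst⁻ : ∀ {C} φ {ρ} x l → C ⊨ (φ [ l / x ]) [ ρ ] → C ⊨ φ [ ρ [ x ≔ l ] ]
    ⊨-subst⁻ (⟨τ⟩ φ) x l (C′ , s , p) = C′ , s , ⊨-subst⁻ φ x l p
    ⊨-subst⁻ (⟨ y ⦅ a ⦆⟩ φ) {ρ} x l (N , c , f) with x ≟ᵛ y
    ... | yes refl = N , c , λ l′ i →
            map₂ (map₂ (⊨-cong φ (ext-shadow ρ x l l′))) (f l′ i)
    ... | no x≢y = N , c , λ l′ i →
            map₂ (map₂ (⊨-cong φ (ext-swap ρ l l′ x≢y) ∘ ⊨-subst⁻ φ x l)) (f l′ i)
    ⊨-subst⁻ (¬̇ φ) x l p q = p (⊨-subst⁺ φ x l q)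
    ⊨-subst⁻ (⋀ K φ) x l p i = ⊨-subst⁻ (φ i) x l (p i)
    ⊨-subst⁻ {C} (hasco v) {ρ} x l (lift p) =
      lift (subst (hascoᵛ C) (applyᵛ-subst ρ x l v) p)

  ⊨-bind : ∀ {C x a φ} →
    C ⊨ ⟨ x ⦅ a ⦆⟩ φ ⇔
    Σ (Pred exTrN 0ℓ) λ N → Cofinite N ×
      (∀ l → l ∈ N → ∃[ C′ ] (C ⇒⟨ l ⟪ a ⟫ ⟩ C′) × C′ ⊨ φ [ l / x ])
  ⊨-bind {φ = φ} = mk⇔
    (λ { (N , c , f) → N , c , λ l i → map₂ (map₂ (⊨-subst⁺ φ _ l)) (f l i) })
    (λ { (N , c , f) → N , c , λ l i → map₂ (map₂ (⊨-subst⁻ φ _ l)) (f l i) })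

{-# OPTIONS --safe #-}
module Submission where

-- As usual, a characteristic formula is the conjunction of formulae separating
-- one configuration from each other one; excluded middle chooses them.  But
-- ⟨ x ⦅ a ⦆⟩ ranges over cofinitely many names, so a move labelled k(a) can only
-- be matched by renaming k to a name not mentioned in the formula, which may
-- not exist if the separating formulae together use infinitely many names.
-- Hence only formulae over the finitely many names of the two histories are
-- used: after a move k(a) that list just grows by k, so agreement on these
-- weaker tests is still a bisimulation.  Transposing k with a fresh l fixes
-- every configuration in which neither occurs, and satisfaction is equivariant.

open import Defs
open import Level using (0ℓ; suc; Lift; lift; lower)
open import Axiom.ExcludedMiddle using (ExcludedMiddle)
open import Axiom.Extensionality.Propositional using (Extensionality)
open import Data.Bool.Base using (true; false; T)
open import Data.Empty using (⊥; ⊥-elim)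
open import Data.Fin.Base as Fin using (Fin)
open import Data.List.Base
  using (List; _++_; map; filter; concatMap; fromMaybe; lookup; tabulate)
import Data.List.Membership.DecPropositional as DecMembership
open import Data.List.Membership.Propositional using (lose) renaming (_∈_ to _∈ₗ_)
open import Data.List.Membership.Propositional.Properties
  using (∈-map⁺; ∈-map⁻; ∈-++⁺ˡ; ∈-++⁺ʳ; ∈-concatMap⁺; ∈-filter⁺; ∈-filter⁻; ∈-lookup; ∈-tabulate⁺)
open import Data.List.Properties using (map-++)
open import Data.List.Relation.Unary.Any using (here; index)
open import Data.List.Relation.Unary.Any.Properties using (lookup-index)
open import Data.Maybe.Base as Maybe using (just; nothing)
open import Data.Nat.Base as ℕ using (ℕ; _≤_)
open import Data.Nat.Properties using (≤-refl; <⇒≤; <⇒≢)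
open import Data.Product.Base as Product using (Σ; ∃-syntax; _×_; _,_; proj₁; proj₂)
open import Data.Sum.Base as Sum using (_⊎_; inj₁; inj₂)
open import Data.Sum.Properties using (inj₂-injective)
open import Data.Vec.Functional using (Vector) renaming (_∷_ to _∷ᵛ_)
open import Function.Base using (_∘_)
open import Function.Bundles using (_⇔_; mk⇔; Equivalence; Inverse)
open import Relation.Binary.Construct.Closure.ReflexiveTransitive using (gmap; fold)
open import Relation.Binary.Core using (Rel)
open import Relation.Binary.PropositionalEquality
  using (_≡_; _≢_; refl; sym; trans; cong; cong₂; subst; subst₂)
open import Relation.Binary.Structures using (IsPartialEquivalence)
open import Relation.Nullary using (¬_; yes; no; contradiction)
open import Relation.Nullary.Decidable as Dec using (True; toWitness; fromWitness)
open import Relation.Unary using (Pred; Decidable; _≐_; _⊆_; _∈_; _∉_; _∪_)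

-- Renaming external names along an involution

module Renaming (ext : Extensionality 0ℓ 0ℓ) (S : Signature)
  (π : Signature.exTrN S → Signature.exTrN S) (π-involutive : ∀ k → π (π k) ≡ k) where

  open Signature S
  open Calculus S
  open DecMembership _≟ᵗ_ using (_∈?_)

  -- Internal names stay put: `internal-tr` and `new-tr` demand an internal label, so these rules
  -- must survive the renaming.
  πⁿ : TrN → TrN
  πⁿ = Sum.map₂ π

  πⁿ-involutive : ∀ k → πⁿ (πⁿ k) ≡ k
  πⁿ-involutive (inj₁ k) = refl
  πⁿ-involutive (inj₂ k) = cong inj₂ (π-involutive k)

  πⁿ-injective : ∀ {k l} → πⁿ k ≡ πⁿ l → k ≡ l
  πⁿ-injective {k} {l} e =
    trans (sym (πⁿ-involutive k)) (trans (cong πⁿ e) (πⁿ-involutive l))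

  πⁿ-swap : ∀ {k l} → πⁿ k ≡ l → k ≡ πⁿ l
  πⁿ-swap refl = sym (πⁿ-involutive _)

  πᵀ : ∀ {m n} → Term m n → Term m n
  πᵀ (sum J μ P)    = sum J μ (λ j → πᵀ (P j))
  πᵀ (P ∣ Q)        = πᵀ P ∣ πᵀ Q
  πᵀ (ν P)          = ν (πᵀ P)
  πᵀ (var X)        = var X
  πᵀ (rec P)        = rec (πᵀ P)
  πᵀ ⟦ P ▷[ k ] Q ⟧ = ⟦ πᵀ P ▷[ πⁿ k ] πᵀ Q ⟧
  πᵀ co             = co
  πᵀ ⟦ P ▶ Q ⟧      = ⟦ πᵀ P ▶ πᵀ Q ⟧

  πˢ : NameSub → NameSub
  πˢ ε        = ε
  πˢ (ks ↦ l) = map πⁿ ks ↦ πⁿ l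

  πᴸ : ∀ {m} → Label m → Label m
  πᴸ ‹ μ ›     = ‹ μ ›
  πᴸ (k ⟪ μ ⟫) = πⁿ k ⟪ μ ⟫

  πᴮ : Reconf → Reconf
  πᴮ (coᵇ k)  = coᵇ (πⁿ k)
  πᴮ (abᵇ k)  = abᵇ (πⁿ k)
  πᴮ (newᵇ k) = newᵇ (πⁿ k)

  -- Precomposition gives the image of `E` under the renaming, since `πⁿ` is its own inverse.
  πᴱ : NameRel → NameRel
  πᴱ E k k′ = E (πⁿ k) (πⁿ k′)

  πᴴ : History → History
  πᴴ H i = Maybe.map (Product.map₁ π) (H i)

  πᴿ : Raw → Raw
  πᴿ ⟨ E ⨾ H ● P ⟩ = ⟨ πᴱ E ⨾ πᴴ H ● πᵀ P ⟩

  πᶻ : ELabel → ELabel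
  πᶻ τ         = τ
  πᶻ (k ⟪ a ⟫) = π k ⟪ a ⟫

  -- Names, variables and well-formedness of renamed terms

  ftn-π⁻ : ∀ {m n} (P : Term m n) {k} → k ∈ ftn (πᵀ P) → πⁿ k ∈ ftn P
  ftn-π⁻ (sum J μ P) (j , p) = j , ftn-π⁻ (P j) p
  ftn-π⁻ (P ∣ Q) = Sum.map (ftn-π⁻ P) (ftn-π⁻ Q)
  ftn-π⁻ (ν P) = ftn-π⁻ P
  ftn-π⁻ (rec P) = ftn-π⁻ P
  ftn-π⁻ ⟦ P ▷[ k ] Q ⟧ = Sum.map πⁿ-swap (Sum.map (ftn-π⁻ P) (ftn-π⁻ Q))
  ftn-π⁻ ⟦ P ▶ Q ⟧ = Sum.map (ftn-π⁻ P) (ftn-π⁻ Q)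

  ftn-π⁺ : ∀ {m n} (P : Term m n) {k} → k ∈ ftn P → πⁿ k ∈ ftn (πᵀ P)
  ftn-π⁺ (sum J μ P) (j , p) = j , ftn-π⁺ (P j) p
  ftn-π⁺ (P ∣ Q) = Sum.map (ftn-π⁺ P) (ftn-π⁺ Q)
  ftn-π⁺ (ν P) = ftn-π⁺ P
  ftn-π⁺ (rec P) = ftn-π⁺ P
  ftn-π⁺ ⟦ P ▷[ k ] Q ⟧ = Sum.map (cong πⁿ) (Sum.map (ftn-π⁺ P) (ftn-π⁺ Q))
  ftn-π⁺ ⟦ P ▶ Q ⟧ = Sum.map (ftn-π⁺ P) (ftn-π⁺ Q)

  fpv-π : ∀ {m n} (P : Term m n) {X} → X ∈ fpv (πᵀ P) → X ∈ fpv P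
  fpv-π (sum J μ P) (j , p) = j , fpv-π (P j) p
  fpv-π (P ∣ Q)             = Sum.map (fpv-π P) (fpv-π Q)
  fpv-π (ν P)               = fpv-π P
  fpv-π (var X) p           = p
  fpv-π (rec P)             = fpv-π P
  fpv-π ⟦ P ▷[ k ] Q ⟧      = Sum.map (fpv-π P) (fpv-π Q)
  fpv-π ⟦ P ▶ Q ⟧           = Sum.map (fpv-π P) (fpv-π Q)

  NoDormant-π : ∀ {m n} (P : Term m n) → NoDormant P → NoDormant (πᵀ P)
  NoDormant-π (sum J μ P) p = λ j → NoDormant-π (P j) (p j)
  NoDormant-π (P ∣ Q) = Product.map (NoDormant-π P) (NoDormant-π Q)
  NoDormant-π (ν P) = NoDormant-π P
  NoDormant-π (var X) p = p
  NoDormant-π (rec P) = NoDormant-π P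
  NoDormant-π ⟦ P ▷[ k ] Q ⟧ = Product.map (NoDormant-π P) (NoDormant-π Q)
  NoDormant-π co p = p

  NoTrN-π : ∀ {m n} (P : Term m n) → NoTrN P → NoTrN (πᵀ P)
  NoTrN-π P p k q = p (πⁿ k) (ftn-π⁻ P q)

  ClosedTerm-π : ∀ {m n} (P : Term m n) → ClosedTerm P → ClosedTerm (πᵀ P)
  ClosedTerm-π P p X q = p X (fpv-π P q)

  SubtermsOK-π : ∀ {m n} (P : Term m n) → SubtermsOK P → SubtermsOK (πᵀ P)
  SubtermsOK-π (sum J μ P) p j with n , d , s ← p j =
    NoTrN-π (P j) n , NoDormant-π (P j) d , SubtermsOK-π (P j) s
  SubtermsOK-π (P ∣ Q)     = Product.map (SubtermsOK-π P) (SubtermsOK-π Q)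
  SubtermsOK-π (ν P)       = SubtermsOK-π P
  SubtermsOK-π (var X) p   = p
  SubtermsOK-π (rec P)     = Product.map (NoTrN-π P) (SubtermsOK-π P)
  SubtermsOK-π ⟦ P ▷[ k ] Q ⟧ (n , n′ , d , c , s , s′) =
    NoTrN-π P n , NoTrN-π Q n′ , NoDormant-π P d , ClosedTerm-π P c ,
    SubtermsOK-π P s , SubtermsOK-π Q s′
  SubtermsOK-π co p        = p
  SubtermsOK-π ⟦ P ▶ Q ⟧ (n , n′ , d , c , s , s′) =
    NoTrN-π P n , NoTrN-π Q n′ , NoDormant-π P d , ClosedTerm-π P c ,
    SubtermsOK-π P s , SubtermsOK-π Q s′

  -- Equations between renamed terms

  πᵀ-fixed : ∀ {m n} (P : Term m n) → (∀ {k} → k ∈ ftn P → πⁿ k ≡ k) → πᵀ P ≡ P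
  -- A sum stores its summands as a function, so equality of sums goes through `ext`; the same holds
  -- in the lemmas below.
  πᵀ-fixed (sum J μ P) f = cong (sum J μ) (ext λ j → πᵀ-fixed (P j) (f ∘ (j ,_)))
  πᵀ-fixed (P ∣ Q) f     = cong₂ _∣_ (πᵀ-fixed P (f ∘ inj₁)) (πᵀ-fixed Q (f ∘ inj₂))
  πᵀ-fixed (ν P) f       = cong ν (πᵀ-fixed P f)
  πᵀ-fixed (var X) f     = refl
  πᵀ-fixed (rec P) f     = cong rec (πᵀ-fixed P f)
  πᵀ-fixed ⟦ P ▷[ k ] Q ⟧ f
    rewrite f {k} (inj₁ refl)
          | πᵀ-fixed P (f ∘ inj₂ ∘ inj₁)
          | πᵀ-fixed Q (f ∘ inj₂ ∘ inj₂) = refl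
  πᵀ-fixed co f          = refl
  πᵀ-fixed ⟦ P ▶ Q ⟧ f   = cong₂ ⟦_▶_⟧ (πᵀ-fixed P (f ∘ inj₁)) (πᵀ-fixed Q (f ∘ inj₂))

  πᵀ-involutive : ∀ {m n} (P : Term m n) → πᵀ (πᵀ P) ≡ P
  πᵀ-involutive (sum J μ P)    = cong (sum J μ) (ext λ j → πᵀ-involutive (P j))
  πᵀ-involutive (P ∣ Q)        = cong₂ _∣_ (πᵀ-involutive P) (πᵀ-involutive Q)
  πᵀ-involutive (ν P)          = cong ν (πᵀ-involutive P)
  πᵀ-involutive (var X)        = refl
  πᵀ-involutive (rec P)        = cong rec (πᵀ-involutive P)
  πᵀ-involutive ⟦ P ▷[ k ] Q ⟧
    rewrite πᵀ-involutive P | πⁿ-involutive k | πᵀ-involutive Q = refl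
  πᵀ-involutive co             = refl
  πᵀ-involutive ⟦ P ▶ Q ⟧      = cong₂ ⟦_▶_⟧ (πᵀ-involutive P) (πᵀ-involutive Q)

  ren-π : ∀ {m m′ n n′} {f : Fin m → Fin m′} {g : Fin n → Fin n′} (P : Term m n) →
          πᵀ (ren f g P) ≡ ren f g (πᵀ P)
  ren-π (sum J μ P)    = cong (sum J _) (ext λ j → ren-π (P j))
  ren-π (P ∣ Q)        = cong₂ _∣_ (ren-π P) (ren-π Q)
  ren-π (ν P)          = cong ν (ren-π P)
  ren-π (var X)        = refl
  ren-π (rec P)        = cong rec (ren-π P)
  ren-π ⟦ P ▷[ k ] Q ⟧ = cong₂ ⟦_▷[ _ ]_⟧ (ren-π P) (ren-π Q)
  ren-π co             = refl
  ren-π ⟦ P ▶ Q ⟧      = cong₂ ⟦_▶_⟧ (ren-π P) (ren-π Q)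

  -- Relating two substitutions pointwise, instead of fixing the renamed one, lets the induction
  -- pass under `ν` and `rec`, where the substitution itself changes.
  sub-π : ∀ {m n n′} {s s′ : Fin n → Term m n′} (P : Term m n) →
          (∀ X → πᵀ (s X) ≡ s′ X) → πᵀ (sub s P) ≡ sub s′ (πᵀ P)
  sub-π (sum J μ P) e    = cong (sum J μ) (ext λ j → sub-π (P j) e)
  sub-π (P ∣ Q) e        = cong₂ _∣_ (sub-π P e) (sub-π Q e)
  sub-π {s = s} (ν P) e  =
    cong ν (sub-π P λ X → trans (ren-π (s X)) (cong (renᶜ Fin.suc) (e X)))
  sub-π (var X) e        = e X
  sub-π {s = s} (rec P) e = cong rec (sub-π P λ where
    Fin.zero    → refl
    (Fin.suc X) → trans (ren-π (s X)) (cong (ren (λ c → c) Fin.suc) (e X)))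
  sub-π ⟦ P ▷[ k ] Q ⟧ e = cong₂ ⟦_▷[ _ ]_⟧ (sub-π P e) (sub-π Q e)
  sub-π co e             = refl
  sub-π ⟦ P ▶ Q ⟧ e      = cong₂ ⟦_▶_⟧ (sub-π P e) (sub-π Q e)

  [/0]-π : ∀ {m n} (P : Term m (ℕ.suc n)) Q → πᵀ (P [ Q /0]) ≡ πᵀ P [ πᵀ Q /0]
  [/0]-π P Q = sub-π P λ { Fin.zero → refl ; (Fin.suc X) → refl }

  ∈-map-π⁻ : ∀ {ks k} → k ∈ₗ map πⁿ ks → πⁿ k ∈ₗ ks
  ∈-map-π⁻ {ks} p with k , q , refl ← ∈-map⁻ πⁿ p = subst (_∈ₗ ks) (sym (πⁿ-involutive k)) q

  -- Membership of `k` in `ks` and of `πⁿ k` in `map πⁿ ks` agree because `πⁿ` undoes itself, so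
  -- both mixed cases are contradictory.
  substᵗ-π : ∀ σ k → πⁿ (substᵗ σ k) ≡ substᵗ (πˢ σ) (πⁿ k)
  substᵗ-π ε k = refl
  substᵗ-π (ks ↦ l) k with k ∈? ks | πⁿ k ∈? map πⁿ ks
  ... | yes _ | yes _ = refl
  ... | yes p | no ¬q = contradiction (∈-map⁺ πⁿ p) ¬q
  ... | no ¬p | yes q = contradiction (subst (_∈ₗ ks) (πⁿ-involutive k) (∈-map-π⁻ q)) ¬p
  ... | no _  | no _  = refl

  nameSub-π : ∀ {m n} (P : Term m n) {σ} → πᵀ (P ⟨ σ ⟩) ≡ πᵀ P ⟨ πˢ σ ⟩
  nameSub-π (sum J μ P)    = cong (sum J μ) (ext λ j → nameSub-π (P j))
  nameSub-π (P ∣ Q)        = cong₂ _∣_ (nameSub-π P) (nameSub-π Q)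
  nameSub-π (ν P)          = cong ν (nameSub-π P)
  nameSub-π (var X)        = refl
  nameSub-π (rec P)        = cong rec (nameSub-π P)
  nameSub-π ⟦ P ▷[ k ] Q ⟧ {σ}
    rewrite nameSub-π P {σ} | substᵗ-π σ k | nameSub-π Q {σ} = refl
  nameSub-π co             = refl
  nameSub-π ⟦ P ▶ Q ⟧      = cong₂ ⟦_▶_⟧ (nameSub-π P) (nameSub-π Q)

  -- Equivariance of process and reconfiguration transitions

  ∉ftn-π : ∀ {m n} {P : Term m n} {k} → k ∉ ftn P → πⁿ k ∉ ftn (πᵀ P)
  ∉ftn-π {P = P} k∉ p = k∉ (subst (_∈ ftn P) (πⁿ-involutive _) (ftn-π⁻ P p))

  range-π : ∀ σ {l} → l ∈ range (πˢ σ) → πⁿ l ∈ range σ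
  range-π (ks ↦ l) = πⁿ-swap

  dom-π : ∀ σ {k} → k ∈ dom (πˢ σ) → πⁿ k ∈ dom σ
  dom-π (ks ↦ l) = ∈-map-π⁻

  range♯-π : ∀ {m n} {Q : Term m n} σ → (∀ {l} → l ∈ range σ → l ∉ ftn Q) →
             ∀ {l} → l ∈ range (πˢ σ) → l ∉ ftn (πᵀ Q)
  range♯-π {Q = Q} σ σ♯Q r p = σ♯Q (range-π σ r) (ftn-π⁻ Q p)

  -- Every rule is mapped to itself. The negative side conditions, freshness and `k ≢ l`, survive
  -- because the renaming is injective.
  →-π : ∀ {m} {P Q : Term m 0} {α σ} → P —[ α ∙ σ ]→ Q → πᵀ P —[ πᴸ α ∙ πˢ σ ]→ πᵀ Q
  →-π (choose j) = choose j
  →-π (comm p q) = comm (→-π p) (→-π q)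
  →-π (unfold {P}) rewrite [/0]-π P (rec P) = unfold
  →-π (choose-tr k j e) = choose-tr (πⁿ k) j e
  →-π (step-tr p k≢l) = step-tr (→-π p) (k≢l ∘ πⁿ-injective)
  →-π (comm-tr {k = k} {ls₁} {ls₂} {P′ = P′} {Q′ = Q′} p q)
    rewrite map-++ πⁿ ls₁ ls₂
          | nameSub-π P′ {ls₂ ↦ k} | nameSub-π Q′ {ls₁ ↦ k} = comm-tr (→-π p) (→-π q)
  →-π (parˡ {σ = σ} {Q = Q} p σ♯Q)
    rewrite nameSub-π Q {σ} = parˡ (→-π p) (range♯-π {Q = Q} σ σ♯Q)
  →-π (parʳ {σ = σ} {P} q σ♯P)
    rewrite nameSub-π P {σ} = parʳ (→-π q) (range♯-π {Q = P} σ σ♯P)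
  -- Splitting on the label makes `πᴸ (weaken α)` and `weaken (πᴸ α)` compute to the same term.
  →-π (res {α = ‹ μ ›} p) = res (→-π p)
  →-π (res {α = k ⟪ μ ⟫} p) = res (→-π p)

  -- The families of summands are two functions out of an empty type, which only `ext` identifies.
  -- Hence the transports in the rules that mention `𝟎`.
  𝟎-π : ∀ {m n} → πᵀ {m} {n} 𝟎 ≡ 𝟎
  𝟎-π = cong (sum _ _) (ext λ ())

  ≡ₛ-π : ∀ {m n} {P Q : Term m n} → P ≡ₛ Q → πᵀ P ≡ₛ πᵀ Q
  ≡ₛ-π ≡ₛ-refl           = ≡ₛ-refl
  ≡ₛ-π (≡ₛ-sym p)        = ≡ₛ-sym (≡ₛ-π p)
  ≡ₛ-π (≡ₛ-trans p q)    = ≡ₛ-trans (≡ₛ-π p) (≡ₛ-π q)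
  ≡ₛ-π ∣-comm            = ∣-comm
  ≡ₛ-π ∣-assoc           = ∣-assoc
  ≡ₛ-π (∣-identity {P})  = subst (λ R → πᵀ P ∣ R ≡ₛ πᵀ P) (sym 𝟎-π) ∣-identity
  ≡ₛ-π (ν-swap {P})      =
    subst (λ R → ν (ν (πᵀ P)) ≡ₛ ν (ν R)) (sym (ren-π P)) ν-swap
  ≡ₛ-π ν-𝟎               = subst₂ (λ R R′ → ν R ≡ₛ R′) (sym 𝟎-π) (sym 𝟎-π) ν-𝟎
  ≡ₛ-π (ν-extrude {P} {Q}) =
    subst (λ R → ν (R ∣ πᵀ Q) ≡ₛ πᵀ P ∣ ν (πᵀ Q)) (sym (ren-π P)) ν-extrude
  ≡ₛ-π (sum-reindex f)   = sum-reindex f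
  ≡ₛ-π (sum-cong p)      = sum-cong (λ j → ≡ₛ-π (p j))
  ≡ₛ-π (∣-cong p q)      = ∣-cong (≡ₛ-π p) (≡ₛ-π q)
  ≡ₛ-π (ν-cong p)        = ν-cong (≡ₛ-π p)
  ≡ₛ-π (rec-cong p)      = rec-cong (≡ₛ-π p)
  ≡ₛ-π (▷-cong p q)      = ▷-cong (≡ₛ-π p) (≡ₛ-π q)
  ≡ₛ-π (▶-cong p q)      = ▶-cong (≡ₛ-π p) (≡ₛ-π q)

  ⇝co-π : ∀ {m n} {P Q : Term m n} → P ⇝co Q → πᵀ P ⇝co πᵀ Q
  ⇝co-π co⇝      = subst (co ⇝co_) (sym 𝟎-π) co⇝
  ⇝co-π sum⇝     = sum⇝
  ⇝co-π var⇝     = var⇝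
  ⇝co-π rec⇝     = rec⇝
  ⇝co-π ▶⇝       = ▶⇝
  ⇝co-π (ν⇝ p)   = ν⇝ (⇝co-π p)
  ⇝co-π (∣⇝ p q) = ∣⇝ (⇝co-π p) (⇝co-π q)

  Broadcast-π : ∀ {β} → Broadcast β → Broadcast (πᴮ β)
  Broadcast-π co-bc = co-bc
  Broadcast-π ab-bc = ab-bc

  nameᵇ-π : ∀ β → nameᵇ (πᴮ β) ≡ πⁿ (nameᵇ β)
  nameᵇ-π (coᵇ k)  = refl
  nameᵇ-π (abᵇ k)  = refl
  nameᵇ-π (newᵇ k) = refl

  nameᵇ♯-π : ∀ {m n} {P : Term m n} β → nameᵇ β ∉ ftn P → nameᵇ (πᴮ β) ∉ ftn (πᵀ P)
  nameᵇ♯-π {P = P} β k∉ = ∉ftn-π {P = P} k∉ ∘ subst (_∈ ftn (πᵀ P)) (nameᵇ-π β)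

  →ʳ-π : ∀ {m} {P Q : Term m 0} {β} → P —[ β ]→ʳ Q → πᵀ P —[ πᴮ β ]→ʳ πᵀ Q
  →ʳ-π (commit p q) = commit (≡ₛ-π p) (⇝co-π q)
  →ʳ-π start = start
  →ʳ-π abort = abort
  →ʳ-π (both b p q) = both (Broadcast-π b) (→ʳ-π p) (→ʳ-π q)
  →ʳ-π (parˡ {β} {Q = Q} p β♯Q) = parˡ (→ʳ-π p) (nameᵇ♯-π {P = Q} β β♯Q)
  →ʳ-π (parʳ {β} {P} q β♯P) = parʳ (→ʳ-π q) (nameᵇ♯-π {P = P} β β♯P)
  →ʳ-π (res p) = res (→ʳ-π p)

  -- Renaming of name equivalences and histories

  holds-π⁺ : ∀ {E k k′} → holds E k k′ → holds (πᴱ E) (πⁿ k) (πⁿ k′)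
  holds-π⁺ {E} = subst₂ (holds E) (sym (πⁿ-involutive _)) (sym (πⁿ-involutive _))

  dom-π⁺ : ∀ σ {k} → k ∈ dom σ → πⁿ k ∈ dom (πˢ σ)
  dom-π⁺ (ks ↦ l) = ∈-map⁺ πⁿ

  range-π⁺ : ∀ σ {k} → k ∈ range σ → πⁿ k ∈ range (πˢ σ)
  range-π⁺ (ks ↦ l) = cong πⁿ

  -- Since `represents` is a logical equivalence, the generated relation has to be transported in
  -- both directions; each constructor goes to itself.
  Merge-π⁺ : ∀ {σ E k k′} → Merge σ E k k′ → Merge (πˢ σ) (πᴱ E) (πⁿ k) (πⁿ k′)
  Merge-π⁺ {E = E} (old p) = old (holds-π⁺ {E} p)
  Merge-π⁺ {σ} (target r)  = target (range-π⁺ σ r)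
  Merge-π⁺ {σ} (source d r) = source (dom-π⁺ σ d) (range-π⁺ σ r)
  Merge-π⁺ (symm p)        = symm (Merge-π⁺ p)
  Merge-π⁺ (tran p q)      = tran (Merge-π⁺ p) (Merge-π⁺ q)

  Merge-π⁻ : ∀ {σ E k k′} → Merge (πˢ σ) (πᴱ E) k k′ → Merge σ E (πⁿ k) (πⁿ k′)
  Merge-π⁻ (old p)          = old p
  Merge-π⁻ {σ} (target r)   = target (range-π σ r)
  Merge-π⁻ {σ} (source d r) = source (dom-π σ d) (range-π σ r)
  Merge-π⁻ (symm p)         = symm (Merge-π⁻ p)
  Merge-π⁻ (tran p q)       = tran (Merge-π⁻ p) (Merge-π⁻ q)

  represents-Merge-π : ∀ {σ E E′} → E′ represents Merge σ E →
                       πᴱ E′ represents Merge (πˢ σ) (πᴱ E)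
  represents-Merge-π {σ} {E} r k k′ = mk⇔
    (subst₂ (Merge (πˢ σ) (πᴱ E)) (πⁿ-involutive k) (πⁿ-involutive k′) ∘ Merge-π⁺ ∘ to)
    (from ∘ Merge-π⁻)
    where open Equivalence (r (πⁿ k) (πⁿ k′))

  represents-⊕-π : ∀ {k E E′} → E′ represents (E ⊕ k) → πᴱ E′ represents (πᴱ E ⊕ πⁿ k)
  represents-⊕-π r k k′ = mk⇔
    (Sum.map₂ (Product.map πⁿ-swap πⁿ-swap) ∘ to)
    (from ∘ Sum.map₂ (Product.map (sym ∘ πⁿ-swap ∘ sym) (sym ∘ πⁿ-swap ∘ sym)))
    where open Equivalence (r (πⁿ k) (πⁿ k′))

  πᴴ-just⁺ : ∀ {H i k s} → H i ≡ just (k , s) → πᴴ H i ≡ just (π k , s)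
  πᴴ-just⁺ e = cong (Maybe.map (Product.map₁ π)) e

  πᴴ-just⁻ : ∀ H {i k s} → πᴴ H i ≡ just (k , s) → H i ≡ just (π k , s)
  πᴴ-just⁻ H {i} e with H i
  πᴴ-just⁻ H refl | just (k , s) = cong (λ l → just (l , s)) (sym (π-involutive k))

  trn-π⁺ : ∀ {H} k → k ∈ trnᴴ H → πⁿ k ∈ trnᴴ (πᴴ H)
  trn-π⁺ {H} (inj₂ k) (i , s , e) = i , s , πᴴ-just⁺ {H} e

  trn-π⁻ : ∀ {H} k → k ∈ trnᴴ (πᴴ H) → πⁿ k ∈ trnᴴ H
  trn-π⁻ {H} (inj₂ k) (i , s , e) = i , s , πᴴ-just⁻ H e

  domᴴ-π⁻ : ∀ {H i} → i ∈ domᴴ (πᴴ H) → i ∈ domᴴ H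
  domᴴ-π⁻ {H} (_ , e) = _ , πᴴ-just⁻ H e

  Hasco-π⁺ : ∀ {H k} → k ∈ Hascoᴴ H → π k ∈ Hascoᴴ (πᴴ H)
  Hasco-π⁺ {H} (i , e) = i , πᴴ-just⁺ {H} e

  Hasco-π⁻ : ∀ {H k} → k ∈ Hascoᴴ (πᴴ H) → π k ∈ Hascoᴴ H
  Hasco-π⁻ {H} (i , e) = i , πᴴ-just⁻ H e

  Fresh-π : ∀ k E H → Fresh k E H → Fresh (πⁿ k) (πᴱ E) (πᴴ H)
  Fresh-π k E H (k∉E , k∉H) =
    k∉E ∘ subst (λ l → holds E l l) (πⁿ-involutive k) ,
    k∉H ∘ subst (_∈ trnᴴ H) (πⁿ-involutive k) ∘ trn-π⁻ (πⁿ k)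

  resolve-π : ∀ s E k H → πᴴ (resolve s E k H) ≡ resolve s (πᴱ E) (πⁿ k) (πᴴ H)
  resolve-π s E k H = ext pointwise
    where
    pointwise : ∀ i → πᴴ (resolve s E k H) i ≡ resolve s (πᴱ E) (πⁿ k) (πᴴ H) i
    pointwise i with H i
    ... | nothing = refl
    -- The test on the right applies `E` to names renamed twice; cancelling the involution in both
    -- arguments yields the test on the left.
    ... | just (k′ , t) rewrite π-involutive k′ | πⁿ-involutive k = refl

  ↪-π : ∀ H i k s → πᴴ (H , i ↪ (k , s)) ≡ (πᴴ H , i ↪ (π k , s))
  ↪-π H i k s = ext pointwise
    where
    pointwise : ∀ j → πᴴ (H , i ↪ (k , s)) j ≡ (πᴴ H , i ↪ (π k , s)) j
    pointwise j with i ≟ᴵ j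
    ... | yes _ = refl
    ... | no _  = refl

  -- Equivariance of extended transitions and of validity

  —→-π : ∀ {C D ζ} → C —⟨ ζ ⟩→ D → πᴿ C —⟨ πᶻ ζ ⟩→ πᴿ D
  —→-π (internal p) = internal (→-π p)
  —→-π (internal-tr {E} {H = H} {k = k} p f r) =
    internal-tr (→-π p) (Fresh-π (inj₁ k) E H f) (represents-Merge-π r)
  —→-π (new-tr {E} {H} {k = k} p f) = new-tr (→ʳ-π p) (Fresh-π (inj₁ k) E H f)
  —→-π (commit-tr {E} {H} {k = k} p) rewrite resolve-π committed E k H = commit-tr (→ʳ-π p)
  —→-π (abort-tr {E} {H} {k = k} p)  rewrite resolve-π aborted E k H = abort-tr (→ʳ-π p)
  —→-π (external {E} {H = H} {k = k} {a} {i = i} p f i∉ r)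
    rewrite ↪-π H i k (performed a) =
    external (→-π p) (Fresh-π (inj₂ k) E H f) (i∉ ∘ domᴴ-π⁻ {H}) (represents-Merge-π r)
  —→-π (external-ab {E} {H = H} {P} {k} {i = i} f k∉ i∉ r)
    rewrite ↪-π H i k aborted =
    external-ab (Fresh-π (inj₂ k) E H f) (∉ftn-π {P = P} k∉) (i∉ ∘ domᴴ-π⁻ {H})
      (represents-⊕-π r)

  Finite-π : {U V : Pred TrN 0ℓ} → Finite U → (∀ {k} → k ∈ V → πⁿ k ∈ U) → Finite V
  Finite-π (ks , ∈ks) f = map πⁿ ks , λ {k} k∈V →
    subst (_∈ₗ map πⁿ ks) (πⁿ-involutive k) (∈-map⁺ πⁿ (∈ks (f k∈V)))

  -- Each condition on the renamed configuration is pulled back to the same condition on `C`, and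
  -- its conclusion is pushed forward again.
  Valid-π : ∀ {C} → Valid C → Valid (πᴿ C)
  Valid-π {⟨ E ⨾ H ● P ⟩} v = record
    { isProcess   = Product.map (λ fin → Finite-π fin (ftn-π⁻ P)) (SubtermsOK-π P) isProcess
    ; equivalence = record { sym = PE.sym ; trans = PE.trans }
    ; finiteField = Finite-π finiteField λ p → p
    ; finiteHist  = Product.map₂ (λ f d → f (domᴴ-π⁻ {H} d)) finiteHist
    ; uniqueIndex = λ e e′ → uniqueIndex (πᴴ-just⁻ H e) (πᴴ-just⁻ H e′)
    ; field⇔trn   = λ k → mk⇔
        (subst (_∈ trnᴴ (πᴴ H)) (πⁿ-involutive (inj₂ k)) ∘ trn-π⁺ {H} (πⁿ (inj₂ k))
          ∘ Equivalence.to (field⇔trn (π k)))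
        (Equivalence.from (field⇔trn (π k)) ∘ trn-π⁻ {H} (inj₂ k))
    ; hasco-resp  = λ {k} {k′} p → mk⇔
        (hasco-π k′ ∘ Equivalence.to (hasco-resp p) ∘ Hasco-π⁻ {H})
        (hasco-π k ∘ Equivalence.from (hasco-resp p) ∘ Hasco-π⁻ {H})
    ; ftn∩hasco   = λ k∈P k∈H → ftn∩hasco (ftn-π⁻ P k∈P) (Hasco-π⁻ {H} k∈H)
    ; ftn-unique  = λ p k∈P k′∈P →
        πⁿ-injective (ftn-unique p (ftn-π⁻ P k∈P) (ftn-π⁻ P k′∈P))
    ; ftn⊆trn     = λ {k} k∈P →
        subst (_∈ trnᴴ (πᴴ H)) (πⁿ-involutive (inj₂ k))
          (trn-π⁺ {H} (πⁿ (inj₂ k)) (ftn⊆trn (ftn-π⁻ P k∈P)))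
    }
    where
    open Valid v
    module PE = IsPartialEquivalence equivalence
    hasco-π : ∀ k → π k ∈ Hascoᴴ H → k ∈ Hascoᴴ (πᴴ H)
    hasco-π k = subst (_∈ Hascoᴴ (πᴴ H)) (π-involutive k) ∘ Hasco-π⁺ {H}

  πᶜ : Config → Config
  πᶜ (config r v) = config (πᴿ r) (Valid-π v)

  →ᵉ-π : ∀ C D {ζ} → C →ᵉ⟨ ζ ⟩ D → πᶜ C →ᵉ⟨ πᶻ ζ ⟩ πᶜ D
  →ᵉ-π C D = —→-π

  ⇒-π : ∀ {C D} → C ⇒ D → πᶜ C ⇒ πᶜ D
  ⇒-π = gmap πᶜ (λ {C} {D} → →ᵉ-π C D)

  ⇒⟨⟩-π : ∀ ζ {C D} → C ⇒⟨ ζ ⟩ D → πᶜ C ⇒⟨ πᶻ ζ ⟩ πᶜ D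
  ⇒⟨⟩-π τ s                               = ⇒-π s
  ⇒⟨⟩-π (k ⟪ a ⟫) (C′ , D′ , s , t , s′)  = πᶜ C′ , πᶜ D′ , ⇒-π s , →ᵉ-π C′ D′ t , ⇒-π s′

  -- Equality of configurations and those fixed by a renaming

  -- Holds by `refl` because the validity field is irrelevant.
  config-≡ : ∀ {C D} → Config.raw C ≡ Config.raw D → C ≡ D
  config-≡ refl = refl

  raw-≡ : ∀ {E E′ H H′ P P′} → (∀ k k′ → E k k′ ≡ E′ k k′) → (∀ i → H i ≡ H′ i) → P ≡ P′ →
          ⟨ E ⨾ H ● P ⟩ ≡ ⟨ E′ ⨾ H′ ● P′ ⟩
  raw-≡ e h refl with refl ← ext (λ k → ext (e k)) | refl ← ext h = refl

  πᶜ-involutive : ∀ C → πᶜ (πᶜ C) ≡ C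
  πᶜ-involutive (config ⟨ E ⨾ H ● P ⟩ _) = config-≡ (raw-≡
    (λ k k′ → cong₂ E (πⁿ-involutive k) (πⁿ-involutive k′))
    πᴴ-involutive
    (πᵀ-involutive P))
    where
    πᴴ-involutive : ∀ i → πᴴ (πᴴ H) i ≡ H i
    πᴴ-involutive i with H i
    ... | nothing      = refl
    ... | just (k , s) = cong (λ l → just (l , s)) (π-involutive k)

  T-ext : ∀ {x y} → (T x → T y) → (T y → T x) → x ≡ y
  T-ext {false} {false} f g = refl
  T-ext {false} {true}  f g = ⊥-elim (g _)
  T-ext {true}  {false} f g = ⊥-elim (f _)
  T-ext {true}  {true}  f g = refl

  -- By `field⇔trn` and `ftn⊆trn`, every external name of the equivalence or of the process already
  -- occurs in the history, so fixing the history names fixes everything.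
  πᴿ-fixed : ∀ {C} → Valid C → (∀ {k} → inj₂ k ∈ trnᴴ (Raw.hist C) → π k ≡ k) → πᴿ C ≡ C
  πᴿ-fixed {⟨ E ⨾ H ● P ⟩} v fixed = raw-≡
    (λ k k′ → T-ext
      -- Here `πⁿ k` and `πⁿ k′` are the names known to lie in the field, so `field-fixed` speaks of
      -- a double renaming and injectivity cancels one layer.
      (λ p → subst₂ (holds E)
        (πⁿ-injective (field-fixed (reflˡ p))) (πⁿ-injective (field-fixed (reflʳ p))) p)
      (λ p → subst₂ (holds E)
        (sym (field-fixed (reflˡ p))) (sym (field-fixed (reflʳ p))) p))
    hist-fixed
    (πᵀ-fixed P λ {k} → proc-fixed k)
    where
    open Valid v
    module PE = IsPartialEquivalence equivalence
    reflˡ : ∀ {k k′} → holds E k k′ → k ∈ field′ E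
    reflˡ p = PE.trans p (PE.sym p)
    reflʳ : ∀ {k k′} → holds E k k′ → k′ ∈ field′ E
    reflʳ p = PE.trans (PE.sym p) p
    field-fixed : ∀ {k} → k ∈ field′ E → πⁿ k ≡ k
    field-fixed {inj₁ k} p = refl
    field-fixed {inj₂ k} p = cong inj₂ (fixed (Equivalence.to (field⇔trn k) p))
    proc-fixed : ∀ k → k ∈ ftn P → πⁿ k ≡ k
    proc-fixed (inj₁ k) p = refl
    proc-fixed (inj₂ k) p = cong inj₂ (fixed (ftn⊆trn p))
    hist-fixed : ∀ i → πᴴ H i ≡ H i
    hist-fixed i with H i in e
    ... | nothing      = refl
    ... | just (k , s) = cong (λ l → just (l , s)) (fixed (i , s , e))

-- External names along transitions

module Names (S : Signature) where

  open Signature S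
  open Calculus S

  -- By validity these are all the external names of a configuration.
  names : Config → Pred exTrN 0ℓ
  names C k = inj₂ k ∈ trnᴴ (Config.hist C)

  trn-resolve : ∀ s E l H → trnᴴ H ≐ trnᴴ (resolve s E l H)
  trn-resolve s E l H = (λ {k} → to k) , (λ {k} → from k)
    where
    to : ∀ k → k ∈ trnᴴ H → k ∈ trnᴴ (resolve s E l H)
    to (inj₂ k) (i , t , e) = i , _ , cong (Maybe.map _) e
    from : ∀ k → k ∈ trnᴴ (resolve s E l H) → k ∈ trnᴴ H
    from (inj₂ k) (i , t , e) with H i in e′
    from (inj₂ k) (i , t , refl) | just (k , t′) = i , t′ , e′

  -- Among the silent rules only commit and abort touch the history, and they change statuses but
  -- not names.
  trn-τ : ∀ {C D} → C —⟨ τ ⟩→ D → trnᴴ (Raw.hist C) ≐ trnᴴ (Raw.hist D)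
  trn-τ (internal _) = (λ p → p) , (λ p → p)
  trn-τ (internal-tr _ _ _) = (λ p → p) , (λ p → p)
  trn-τ (new-tr _ _) = (λ p → p) , (λ p → p)
  trn-τ (commit-tr {E} {H} {k = k} _) = trn-resolve committed E k H
  trn-τ (abort-tr {E} {H} {k = k} _) = trn-resolve aborted E k H

  names-⇒ : ∀ {C D} → C ⇒ D → names C ≐ names D
  names-⇒ = fold (λ C D → names C ≐ names D)
    (λ {C} {D} {F} → step {C} {D} {F}) ((λ p → p) , (λ p → p))
    where
    step : ∀ {C D F} → C →ᵉ⟨ τ ⟩ D → names D ≐ names F → names C ≐ names F
    step s (D⊆F , F⊆D) with C⊆D , D⊆C ← trn-τ s =
      (λ p → D⊆F (C⊆D p)) , (λ p → D⊆C (F⊆D p))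

  trn-↪ : ∀ H {i k s} → i ∉ domᴴ H →
          ∀ {l} → inj₂ l ∈ trnᴴ (H , i ↪ (k , s)) ⇔ (inj₂ l ∈ trnᴴ H ⊎ l ≡ k)
  trn-↪ H {i} {k} {s} i∉ {l} = mk⇔ to Sum.[ old′ , new ]
    where
    to : inj₂ l ∈ trnᴴ (H , i ↪ (k , s)) → inj₂ l ∈ trnᴴ H ⊎ l ≡ k
    to (j , t , e) with i ≟ᴵ j
    to (j , t , refl) | yes _ = inj₂ refl
    to (j , t , e)    | no _  = inj₁ (j , t , e)
    old′ : inj₂ l ∈ trnᴴ H → inj₂ l ∈ trnᴴ (H , i ↪ (k , s))
    old′ (j , t , e) = j , t , lemma
      where
      lemma : (H , i ↪ (k , s)) j ≡ just (l , t)
      lemma with i ≟ᴵ j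
      ... | yes refl = contradiction (_ , e) i∉
      ... | no _     = e
    new : l ≡ k → inj₂ l ∈ trnᴴ (H , i ↪ (k , s))
    new refl = i , s , lemma
      where
      lemma : (H , i ↪ (k , s)) i ≡ just (k , s)
      lemma with i ≟ᴵ i
      ... | yes _  = refl
      ... | no i≢i = contradiction refl i≢i

  trn-vis : ∀ {C D k a} → C —⟨ k ⟪ a ⟫ ⟩→ D → inj₂ k ∉ trnᴴ (Raw.hist C) ×
            (∀ {l} → inj₂ l ∈ trnᴴ (Raw.hist D) ⇔ (inj₂ l ∈ trnᴴ (Raw.hist C) ⊎ l ≡ k))
  trn-vis (external {H = H} _ (_ , k∉H) i∉ _)    = k∉H , trn-↪ H i∉
  trn-vis (external-ab {H = H} (_ , k∉H) _ i∉ _) = k∉H , trn-↪ H i∉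

  -- The rule asks for freshness of `k` only where the label fires; silent moves keep the names, so
  -- this transfers back to `C`.
  names-⇒⟨⟩ : ∀ {C D k a} → C ⇒⟨ k ⟪ a ⟫ ⟩ D →
              k ∉ names C × (∀ {l} → l ∈ names D ⇔ (l ∈ names C ⊎ l ≡ k))
  names-⇒⟨⟩ (C′ , D′ , s , t , s′)
    with C⊆C′ , C′⊆C ← names-⇒ s | k∉C′ , D′⇔C′ ← trn-vis t | D′⊆D , D⊆D′ ← names-⇒ s′ =
    k∉C′ ∘ C⊆C′ ,
    mk⇔ (Sum.map₁ C′⊆C ∘ Equivalence.to D′⇔C′ ∘ D⊆D′)
        (D′⊆D ∘ Equivalence.from D′⇔C′ ∘ Sum.map₁ C⊆C′)

-- A finitely named logic and its translation into `Form`

-- Formulae with finitely many names: variables are de Bruijn indices and the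
-- environment supplies the names.
module NamedLogic (S : Signature) where

  open Signature S
  open Calculus S

  data Fm (n : ℕ) : Set₁ where
    ◇τ     : Fm n → Fm n
    ◇      : Act → Fm (ℕ.suc n) → Fm n
    neg    : Fm n → Fm n
    conj   : (K : Set) → (K → Fm n) → Fm n
    hascoᶠ : Fin n → Fm n

  infix 4 _⊩_[_]

  _⊩_[_] : ∀ {n} → Config → Fm n → Vector exTrN n → Set₁
  C ⊩ ◇τ φ [ ρ ]     = ∃[ C′ ] (C ⇒⟨ τ ⟩ C′) × C′ ⊩ φ [ ρ ]
  C ⊩ ◇ a φ [ ρ ]    = Σ (Pred exTrN 0ℓ) λ N → Cofinite N ×
    (∀ l → l ∈ N → ∃[ C′ ] (C ⇒⟨ l ⟪ a ⟫ ⟩ C′) × C′ ⊩ φ [ l ∷ᵛ ρ ])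
  C ⊩ neg φ [ ρ ]    = ¬ (C ⊩ φ [ ρ ])
  C ⊩ conj K φ [ ρ ] = (i : K) → C ⊩ φ i [ ρ ]
  C ⊩ hascoᶠ i [ ρ ] = Lift (suc 0ℓ) (ρ i ∈ Hasco C)

  nthVar : ℕ → Var
  nthVar = Inverse.from Var-countable

  nthVar-injective : ∀ {i j} → nthVar i ≡ nthVar j → i ≡ j
  nthVar-injective {i} {j} e = trans (sym (inverseˡ refl)) (inverseˡ e)
    where open Inverse Var-countable

  -- `d` counts the binders passed, so each nested binder gets a new variable; `v` records the name
  -- or variable that each index stands for.
  toForm : ∀ {n} → ℕ → Vector Value n → Fm n → Form
  toForm d v (◇τ φ)     = ⟨τ⟩ toForm d v φ
  toForm d v (◇ a φ)    = ⟨ nthVar d ⦅ a ⦆⟩ toForm (ℕ.suc d) (inj₂ (nthVar d) ∷ᵛ v) φ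
  toForm d v (neg φ)    = ¬̇ toForm d v φ
  toForm d v (conj K φ) = ⋀ K (λ i → toForm d v (φ i))
  toForm d v (hascoᶠ i) = hasco (v i)

  fv-toForm : ∀ {n d} {v : Vector Value n} φ {y} → y ∈ fv (toForm d v φ) → ∃[ i ] v i ≡ inj₂ y
  fv-toForm (◇τ φ) p             = fv-toForm φ p
  fv-toForm (◇ a φ) (p , y≢x) with fv-toForm φ p
  ... | Fin.zero  , refl = contradiction refl y≢x
  ... | Fin.suc i , e    = i , e
  fv-toForm (neg φ) p            = fv-toForm φ p
  fv-toForm (conj K φ) (i , p)   = fv-toForm (φ i) p
  fv-toForm {v = v} (hascoᶠ i) p with v i in e
  fv-toForm {v = v} (hascoᶠ i) refl | inj₂ x = i , e

  toForm-closed : ∀ {n} {ρ : Vector exTrN n} φ → Closed (toForm 0 (inj₁ ∘ ρ) φ)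
  toForm-closed φ y p with () ← fv-toForm φ p

  -- The freshness invariant that makes `nthVar d` and all later variables safe to bind.
  Below : ∀ {n} → ℕ → Vector Value n → Set
  Below d v = ∀ i {j} → d ≤ j → v i ≢ inj₂ (nthVar j)

  Below-∷ : ∀ {n d} {v : Vector Value n} → Below d v → Below (ℕ.suc d) (inj₂ (nthVar d) ∷ᵛ v)
  Below-∷ b Fin.zero d<j e    = <⇒≢ d<j (nthVar-injective (inj₂-injective e))
  Below-∷ b (Fin.suc i) d<j e = b i (<⇒≤ d<j) e

  Interprets : ∀ {n} → Env → Vector Value n → Vector exTrN n → Set
  Interprets e v ρ = ∀ i → applyᵛ e (v i) ≡ inj₁ (ρ i)

  -- By `Below`, updating the environment at `nthVar d` affects no variable already in `v`.
  Interprets-∷ : ∀ {n d e} {v : Vector Value n} {ρ} l → Below d v → Interprets e v ρ →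
    Interprets (e [ nthVar d ≔ l ]) (inj₂ (nthVar d) ∷ᵛ v) (l ∷ᵛ ρ)
  Interprets-∷ {d = d} l b r Fin.zero with nthVar d ≟ᵛ nthVar d
  ... | yes _  = refl
  ... | no d≢d = contradiction refl d≢d
  Interprets-∷ {d = d} {v = v} l b r (Fin.suc i) with v i in e | r i
  ... | inj₁ k | p = p
  ... | inj₂ x | p with nthVar d ≟ᵛ x
  ...   | yes refl = contradiction e (b i ≤-refl)
  ...   | no _     = p

  mutual
    -- Proved together with its converse because negation exchanges the two directions.
    toForm⁺ : ∀ {n C d e} {v : Vector Value n} {ρ} φ → Below d v → Interprets e v ρ →
              C ⊩ φ [ ρ ] → C ⊨ toForm d v φ [ e ]
    toForm⁺ (◇τ φ) b r (C′ , s , p) = C′ , s , toForm⁺ φ b r p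
    toForm⁺ (◇ a φ) b r (N , c , f) = N , c , λ l l∈N →
      Product.map₂ (Product.map₂ (toForm⁺ φ (Below-∷ b) (Interprets-∷ l b r))) (f l l∈N)
    toForm⁺ (neg φ) b r p q         = p (toForm⁻ φ b r q)
    toForm⁺ (conj K φ) b r p i      = toForm⁺ (φ i) b r (p i)
    toForm⁺ {C = C} (hascoᶠ i) b r (lift p) = lift (subst (hascoᵛ C) (sym (r i)) p)

    toForm⁻ : ∀ {n C d e} {v : Vector Value n} {ρ} φ → Below d v → Interprets e v ρ →
              C ⊨ toForm d v φ [ e ] → C ⊩ φ [ ρ ]
    toForm⁻ (◇τ φ) b r (C′ , s , p) = C′ , s , toForm⁻ φ b r p
    toForm⁻ (◇ a φ) b r (N , c , f) = N , c , λ l l∈N →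
      Product.map₂ (Product.map₂ (toForm⁻ φ (Below-∷ b) (Interprets-∷ l b r))) (f l l∈N)
    toForm⁻ (neg φ) b r p q         = p (toForm⁺ φ b r q)
    toForm⁻ (conj K φ) b r p i      = toForm⁻ (φ i) b r (p i)
    toForm⁻ {C = C} (hascoᶠ i) b r (lift p) = lift (subst (hascoᵛ C) (r i) p)

  -- Starting with names only, the translated formula is closed, and both invariants hold trivially
  -- as `v` contains no variable.
  𝓛⊆⇒⊩ : ∀ {C D} → 𝓛Hasco C ⊆ 𝓛Hasco D →
          ∀ {n} {ρ : Vector exTrN n} φ → C ⊩ φ [ ρ ] → D ⊩ φ [ ρ ]
  𝓛⊆⇒⊩ C⊆D {ρ = ρ} φ p with _ , q ← C⊆D (toForm-closed φ , toForm⁺ φ (λ _ _ ()) (λ _ → refl) p) =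
    toForm⁻ φ (λ _ _ ()) (λ _ → refl) q

-- Equivariance of satisfaction

module Equivariance (ext : Extensionality 0ℓ 0ℓ) (S : Signature)
  (π : Signature.exTrN S → Signature.exTrN S) (π-involutive : ∀ k → π (π k) ≡ k) where

  open Signature S
  open Calculus S
  open Renaming ext S π π-involutive
  open NamedLogic S

  ⊩-π : ∀ {n C} {ρ : Vector exTrN n} φ → C ⊩ φ [ ρ ] → πᶜ C ⊩ φ [ π ∘ ρ ]
  ⊩-π (◇τ φ) (C′ , s , p) = πᶜ C′ , ⇒-π s , ⊩-π φ p
  -- `N ∘ π` is the image of `N`, and its finite list of exceptions is mapped along. The move
  -- labelled `l` is obtained by renaming the one labelled `π l`.
  ⊩-π {C = C} {ρ} (◇ a φ) (N , (ks , ∈ks) , f) = N ∘ π ,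
    (map π ks , λ {k} k∉ → subst (_∈ₗ map π ks) (π-involutive k) (∈-map⁺ π (∈ks k∉))) ,
    λ l l∈N → let C′ , s , p = f (π l) l∈N in
      πᶜ C′ ,
      subst (λ k → πᶜ C ⇒⟨ k ⟪ a ⟫ ⟩ πᶜ C′) (π-involutive l) (⇒⟨⟩-π (π l ⟪ a ⟫) s) ,
      subst (πᶜ C′ ⊩ φ [_])
        (ext λ { Fin.zero → π-involutive l ; (Fin.suc i) → refl }) (⊩-π φ p)
  -- The converse that negation calls for is the same lemma applied to the renamed data, with the
  -- double renaming cancelled.
  ⊩-π {C = C} {ρ} (neg φ) p q = p (subst₂ (_⊩ φ [_])
    (πᶜ-involutive C) (ext (π-involutive ∘ ρ)) (⊩-π φ q))
  ⊩-π (conj K φ) p i      = ⊩-π (φ i) (p i)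
  ⊩-π {C = C} (hascoᶠ i) (lift p) = lift (Hasco-π⁺ {Config.hist C} p)

-- Classical reasoning and transpositions of names

module Completeness (em : ExcludedMiddle (suc 0ℓ)) (ext : Extensionality 0ℓ 0ℓ)
  (S : Signature) where

  open Signature S
  open Calculus S
  open Names S
  open NamedLogic S

  em₀ : ExcludedMiddle 0ℓ
  em₀ = Dec.map′ lower lift em

  -- A decidable proposition can be recomputed from an irrelevant proof, and excluded middle decides
  -- `Valid`.
  valid : ∀ C → Valid (Config.raw C)
  valid (config r v) = Dec.recompute em₀ v

  transpose : exTrN → exTrN → exTrN → exTrN
  transpose k l x with x ≟ᵉˣ k | x ≟ᵉˣ l
  ... | yes _ | _     = l
  ... | no _  | yes _ = k
  ... | no _  | no _  = x

  transpose-fixed : ∀ {k l x} → x ≢ k → x ≢ l → transpose k l x ≡ x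
  transpose-fixed {k} {l} {x} x≢k x≢l with x ≟ᵉˣ k | x ≟ᵉˣ l
  ... | yes x≡k | _       = contradiction x≡k x≢k
  ... | no _    | yes x≡l = contradiction x≡l x≢l
  ... | no _    | no _    = refl

  transposeˡ : ∀ k l → transpose k l k ≡ l
  transposeˡ k l with k ≟ᵉˣ k
  ... | yes _  = refl
  ... | no k≢k = contradiction refl k≢k

  transposeʳ : ∀ k l → transpose k l l ≡ k
  transposeʳ k l with l ≟ᵉˣ k | l ≟ᵉˣ l
  ... | yes refl | _      = refl
  ... | no _     | yes _  = refl
  ... | no _     | no l≢l = contradiction refl l≢l

  transpose-involutive : ∀ k l x → transpose k l (transpose k l x) ≡ x
  transpose-involutive k l x with x ≟ᵉˣ k | x ≟ᵉˣ l
  ... | yes refl | _        = transposeʳ k l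
  ... | no _     | yes refl = transposeˡ k l
  ... | no x≢k   | no x≢l   = transpose-fixed x≢k x≢l

  Covers : ∀ {n} → Vector exTrN n → Config → Set
  Covers ρ C = ∀ {k} → k ∈ names C → ∃[ i ] ρ i ≡ k

  -- Neither `k` nor `l` is in `ρ`, hence neither is a name of `C`: the transposition fixes `C` and
  -- the tail of the environment and only turns `k` into `l`.
  ⇒⟨⟩-rename : ∀ {n C C′ a k l} {ρ : Vector exTrN n} φ → Covers ρ C →
    (∀ i → ρ i ≢ k) → (∀ i → ρ i ≢ l) → C ⇒⟨ k ⟪ a ⟫ ⟩ C′ → C′ ⊩ φ [ k ∷ᵛ ρ ] →
    ∃[ C″ ] (C ⇒⟨ l ⟪ a ⟫ ⟩ C″) × C″ ⊩ φ [ l ∷ᵛ ρ ]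
  ⇒⟨⟩-rename {C = C} {C′} {a} {k} {l} {ρ} φ cover k∉ρ l∉ρ s p =
    πᶜ C′ ,
    subst₂ (λ D m → D ⇒⟨ m ⟪ a ⟫ ⟩ πᶜ C′)
      (config-≡ (πᴿ-fixed (valid C) names-fixed)) (transposeˡ k l) (⇒⟨⟩-π (k ⟪ a ⟫) s) ,
    subst (πᶜ C′ ⊩ φ [_])
      (ext λ { Fin.zero → transposeˡ k l ; (Fin.suc i) → transpose-fixed (k∉ρ i) (l∉ρ i) })
      (⊩-π φ p)
    where
    open Renaming ext S (transpose k l) (transpose-involutive k l)
    open Equivariance ext S (transpose k l) (transpose-involutive k l)
    names-fixed : ∀ {m} → m ∈ names C → transpose k l m ≡ m
    names-fixed m∈C with i , refl ← cover m∈C = transpose-fixed (k∉ρ i) (l∉ρ i)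

  -- Separating and characteristic formulae

  separating : ∀ {n} (ρ : Vector exTrN n) (C D : Config) → Fm n
  separating ρ C D with em {P = Σ (Fm _) λ φ → C ⊩ φ [ ρ ] × ¬ (D ⊩ φ [ ρ ])}
  ... | yes (φ , _) = φ
  -- The empty conjunction, true everywhere, is the default when nothing separates.
  ... | no _        = conj ⊥ λ ()

  separating-holds : ∀ {n} (ρ : Vector exTrN n) C D → C ⊩ separating ρ C D [ ρ ]
  separating-holds ρ C D with em {P = Σ (Fm _) λ φ → C ⊩ φ [ ρ ] × ¬ (D ⊩ φ [ ρ ])}
  ... | yes (φ , p , _) = p
  ... | no _            = λ ()

  -- If `D` satisfies the chosen formula, no separating formula existed; excluded middle turns this
  -- into the implication.
  separating-separates : ∀ {n} (ρ : Vector exTrN n) C D → D ⊩ separating ρ C D [ ρ ] →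
                         ∀ φ → C ⊩ φ [ ρ ] → D ⊩ φ [ ρ ]
  separating-separates ρ C D q φ p
    with em {P = Σ (Fm _) λ φ → C ⊩ φ [ ρ ] × ¬ (D ⊩ φ [ ρ ])}
  ... | yes (ψ , _ , ¬q) = contradiction q ¬q
  ... | no none with em {P = D ⊩ φ [ ρ ]}
  ...   | yes r = r
  ...   | no ¬r = contradiction (φ , p , ¬r) none

  -- `Config` lies in `Set`, so it can index a conjunction with one conjunct per possible answer.
  characteristic : ∀ {n} → Vector exTrN n → Config → Fm n
  characteristic ρ C = conj Config (separating ρ C)

  -- Agreement on finitely named formulae and its transfer along moves

  -- The names in ρ are exactly those of the two histories: all of them are
  -- needed to observe Hasco, and no other ones keep a fresh name outside ρ.
  record _∼_ (C D : Config) : Set₁ where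
    field
      {size}  : ℕ
      ρ       : Vector exTrN size
      coverˡ  : Covers ρ C
      coverʳ  : Covers ρ D
      exact   : ∀ i → ρ i ∈ names C ⊎ ρ i ∈ names D
      implies : ∀ φ → C ⊩ φ [ ρ ] → D ⊩ φ [ ρ ]

  -- Formulae are closed under negation, so classically implication of all of them is equivalence.
  ∼-sym : ∀ {C D} → C ∼ D → D ∼ C
  ∼-sym {C} {D} r = record
    { ρ = ρ ; coverˡ = coverʳ ; coverʳ = coverˡ ; exact = Sum.swap ∘ exact ; implies = implies′ }
    where
    open _∼_ r
    implies′ : ∀ φ → D ⊩ φ [ ρ ] → C ⊩ φ [ ρ ]
    implies′ φ q with em {P = C ⊩ φ [ ρ ]}
    ... | yes p = p
    ... | no ¬p = contradiction q (implies (neg φ) ¬p)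

  -- A committed name is in the history, so some index of `ρ` denotes it and an atomic formula tests
  -- it.
  ∼-hasco : ∀ {C D} → C ∼ D → Hasco C ⊆ Hasco D
  ∼-hasco r (i , e)
    with j , refl ← _∼_.coverˡ r (i , _ , e)
    with lift p ← _∼_.implies r (hascoᶠ j) (lift (i , e)) = p

  -- `D` must answer with a state satisfying the characteristic formula of `C′`. Silent moves keep
  -- the names, so the same `ρ` serves afterwards.
  ∼-τ : ∀ {C D C′} → C ∼ D → C ⇒ C′ → ∃[ D′ ] (D ⇒ D′) × C′ ∼ D′
  ∼-τ {C′ = C′} r s
    with D′ , t , q ← _∼_.implies r (◇τ (characteristic (_∼_.ρ r) C′))
                        (C′ , s , separating-holds (_∼_.ρ r) C′)
    with C⊆C′ , C′⊆C ← names-⇒ s | D⊆D′ , D′⊆D ← names-⇒ t =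
    D′ , t , record
      { ρ       = ρ
      ; coverˡ  = coverˡ ∘ C′⊆C
      ; coverʳ  = coverʳ ∘ D′⊆D
      ; exact   = Sum.map C⊆C′ D⊆D′ ∘ exact
      -- The relevant conjunct is the one indexed by the answer `D′` itself.
      ; implies = separating-separates ρ C′ D′ (q D′)
      }
    where open _∼_ r

  -- A single move suffices: it is renamed to every `l` outside `ρ`, and these form a cofinite set.
  ◇-intro : ∀ {n C C′ k a} {ρ : Vector exTrN n} φ → Covers ρ C → (∀ i → ρ i ≢ k) →
            C ⇒⟨ k ⟪ a ⟫ ⟩ C′ → C′ ⊩ φ [ k ∷ᵛ ρ ] → C ⊩ ◇ a φ [ ρ ]
  ◇-intro {ρ = ρ} φ cover k∉ρ s p =
    (λ l → ∀ i → ρ i ≢ l) , (tabulate ρ , l∈ρ) ,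
    λ l l∉ρ → ⇒⟨⟩-rename φ cover k∉ρ l∉ρ s p
    where
    l∈ρ : ∀ {l} → ¬ (∀ i → ρ i ≢ l) → l ∈ₗ tabulate ρ
    l∈ρ {l} ¬l∉ρ with em₀ {P = ∃[ i ] ρ i ≡ l}
    ... | yes (i , refl) = ∈-tabulate⁺ i
    ... | no ¬l∈ρ        = contradiction (λ i e → ¬l∈ρ (i , e)) ¬l∉ρ

  -- `k` may be among the finitely many exceptions, so a name `l` avoiding them and `ρ` is chosen
  -- first, and the resulting move is renamed from `l` to `k`.
  ◇-elim : ∀ {n C k a} {ρ : Vector exTrN n} φ → Covers ρ C → (∀ i → ρ i ≢ k) →
           C ⊩ ◇ a φ [ ρ ] → ∃[ C′ ] (C ⇒⟨ k ⟪ a ⟫ ⟩ C′) × C′ ⊩ φ [ k ∷ᵛ ρ ]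
  ◇-elim {ρ = ρ} φ cover k∉ρ (N , (ls , ∈ls) , f) with exTrN-infinite (ls ++ tabulate ρ)
  ... | l , l∉ with em₀ {P = l ∈ N}
  ...   | no l∉N = contradiction (∈-++⁺ˡ (∈ls l∉N)) l∉
  ...   | yes l∈N with C′ , s , p ← f l l∈N = ⇒⟨⟩-rename φ cover l∉ρ k∉ρ s p
    where
    l∉ρ : ∀ i → ρ i ≢ l
    l∉ρ i refl = l∉ (∈-++⁺ʳ ls (∈-tabulate⁺ i))

  ∼-vis : ∀ {C D C′ k a} → C ∼ D → C ⇒⟨ k ⟪ a ⟫ ⟩ C′ → (k ⟪ a ⟫) ♯ D →
          ∃[ D′ ] (D ⇒⟨ k ⟪ a ⟫ ⟩ D′) × C′ ∼ D′
  ∼-vis {C} {D} {C′} {k} {a} r s ((_ , k∉D) , _) =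
    let k∉C , C′⇔C = names-⇒⟨⟩ s
        -- By `exact`, `ρ i` is in one of the two histories; `k` is in neither, because it labels a
        -- move of `C` and is fresh for `D`.
        k∉ρ = λ i e → Sum.[ k∉C , k∉D ] (subst (λ l → l ∈ names C ⊎ l ∈ names D) e (exact i))
        χ = characteristic (k ∷ᵛ ρ) C′
        D′ , t , q = ◇-elim χ coverʳ k∉ρ
          (implies (◇ a χ) (◇-intro χ coverˡ k∉ρ s (separating-holds (k ∷ᵛ ρ) C′)))
        _ , D′⇔D = names-⇒⟨⟩ t
    in D′ , t , record
      { ρ       = k ∷ᵛ ρ
      ; coverˡ  = extend {C} {C′} coverˡ C′⇔C
      ; coverʳ  = extend {D} {D′} coverʳ D′⇔D
      ; exact   = λ where
          Fin.zero    → inj₁ (Equivalence.from C′⇔C (inj₂ refl))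
          (Fin.suc i) → Sum.map (Equivalence.from C′⇔C ∘ inj₁)
                                (Equivalence.from D′⇔D ∘ inj₁) (exact i)
      ; implies = separating-separates (k ∷ᵛ ρ) C′ D′ (q D′)
      }
    where
    open _∼_ r
    extend : ∀ {F F′} → Covers ρ F → (∀ {l} → l ∈ names F′ ⇔ (l ∈ names F ⊎ l ≡ k)) →
             Covers (k ∷ᵛ ρ) F′
    extend cover F′⇔F l∈F′ with Equivalence.to F′⇔F l∈F′
    ... | inj₁ l∈F  = Product.map Fin.suc (λ e → e) (cover l∈F)
    ... | inj₂ refl = Fin.zero , refl

  ∼-step : ∀ {C D C′} ζ → C ∼ D → C ⇒⟨ ζ ⟩ C′ → ζ ♯ D → ∃[ D′ ] (D ⇒⟨ ζ ⟩ D′) × C′ ∼ D′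
  ∼-step τ         r s _   = ∼-τ r s
  ∼-step (k ⟪ a ⟫) r s k♯D = ∼-vis r s k♯D

  -- From equal theories to a bisimulation

  Finite-names : ∀ C → Finite (names C)
  Finite-names C with is , ∈is ← Valid.finiteHist (valid C) =
    concatMap name is , λ { (i , s , e) → ∈-concatMap⁺ name (lose (∈is (_ , e)) (∈-name e)) }
    where
    name : I → List exTrN
    name i = fromMaybe (Maybe.map proj₁ (Config.hist C i))
    ∈-name : ∀ {i k s} → Config.hist C i ≡ just (k , s) → k ∈ₗ name i
    ∈-name e rewrite e = here refl

  𝓛⊆⇒∼ : ∀ {C D} → 𝓛Hasco C ⊆ 𝓛Hasco D → C ∼ D
  𝓛⊆⇒∼ {C} {D} C⊆D with ks , ∈ks ← Finite-names C | ls , ∈ls ← Finite-names D = record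
    { ρ       = lookup ms
    ; coverˡ  = λ p → covered (∈-++⁺ˡ (∈ks p)) (inj₁ p)
    ; coverʳ  = λ p → covered (∈-++⁺ʳ ks (∈ls p)) (inj₂ p)
    ; exact   = λ i → proj₂ (∈-filter⁻ occurs? {xs = ks ++ ls} (∈-lookup i))
    ; implies = 𝓛⊆⇒⊩ C⊆D
    }
    where
    occurs? : Decidable (names C ∪ names D)
    occurs? k = em₀
    ms : List exTrN
    -- Finiteness only provides lists containing the names, possibly with extra entries; filtering
    -- removes these, as `exact` requires.
    ms = filter occurs? (ks ++ ls)
    covered : ∀ {k} → k ∈ₗ ks ++ ls → k ∈ names C ∪ names D → ∃[ i ] lookup ms i ≡ k
    covered p q = index p′ , sym (lookup-index p′)
      where p′ = ∈-filter⁺ occurs? p q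

  -- Bisimulations must be valued in Set, so the decision of _∼_ stands for it.
  _∼ᵇ_ : Rel Config 0ℓ
  C ∼ᵇ D = True (em {P = C ∼ D})

  ∼ᵇ-isHascoBisimulation : IsHascoBisimulation _∼ᵇ_
  ∼ᵇ-isHascoBisimulation = record
    { hasco = λ r → ∼-hasco (toWitness r) , ∼-hasco (∼-sym (toWitness r))
    ; forth = λ {_} {_} {_} {ζ} r s ζ♯D →
        Product.map₂ (Product.map₂ fromWitness) (∼-step ζ (toWitness r) s ζ♯D)
    ; back  = λ {_} {_} {_} {ζ} r s ζ♯C →
        Product.map₂ (Product.map₂ (fromWitness ∘ ∼-sym)) (∼-step ζ (∼-sym (toWitness r)) s ζ♯C)
    }

proposition4p5 : ExcludedMiddle (suc 0ℓ) → Extensionality 0ℓ 0ℓ →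
    (S : Signature) → let open Calculus S in
    (C₁ C₂ : Config) → 𝓛Hasco C₁ ≐ 𝓛Hasco C₂ → C₁ ≈Hasco C₂
proposition4p5 em ext S C₁ C₂ (L₁⊆L₂ , _) =
  _∼ᵇ_ , ∼ᵇ-isHascoBisimulation , fromWitness (𝓛⊆⇒∼ L₁⊆L₂)
  where open Completeness em ext S
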